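{- As formal power series in $t$, $$\sum_{n\ge0}R_{1,n}t^n=R_{1,0}\,\frac{Z^{(G_r)}(0,-ty_2,-ty_3,\dots,-ty_{2r+1})}{Z^{(G_r)}(-ty_1,-ty_2,\dots,-ty_{2r+1})},$$ with $y_{2\alpha-1}=\frac{R_{\alpha-1,0}R_{\alpha,1}}{R_{\alpha,0}R_{\alpha-1,1}}$ ($1\le\alpha\le r+1$) and $y_{2\alpha}=\frac{R_{\alpha-1,0}R_{\alpha+1,1}}{R_{\alpha,0}R_{\alpha,1}}$ ($1\le\alpha\le r$).
   Context: Fix $r\ge1$, $I_r=\{1,\dots,r\}$. Let $R_{1,0},\dots,R_{r,0},R_{1,1},\dots,R_{r,1}$ be algebraically independent indeterminates over $\mathbb Q$ and $(R_{\alpha,n})_{0\le\alpha\le r+1,n\in\mathbb Z}$ the $A_r$ $Q$-system: the unique family of nonzero elements of $\mathbb Q(R_{1,0},\dots,R_{r,1})$ with these initial values, $R_{0,n}=R_{r+1,n}=1$, and $R_{\alpha,n+1}R_{\alpha,n-1}=R_{\alpha,n}^2+R_{\alpha+1,n}R_{\alpha-1,n}$ ($\alpha\in I_r$, $n\in\mathbb Z$). The graph $G_r$ has vertices $1,\dots,2r+1$ and edges $\{1,2\}$, $\{2k,2k+1\}$ ($1\le k\le r$), $\{2k-2,2k\}$ and $\{2k-1,2k\}$ ($2\le k\le r$). A hard particle configuration is a set of vertices no two of which are adjacent; with vertex weights $z_1,\dots,z_{2r+1}$, $Z^{(G_r)}(z_1,\dots,z_{2r+1})=\sum_C\prod_{i\in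 C}z_i$, summed over all hard particle configurations $C$ on $G_r$ (including the empty one). -}

module Defs where

open import Level using (_⊔_; 0ℓ) renaming (suc to lsuc)
open import Algebra.Bundles using (CommutativeRing; RawRing)
open import Algebra.Morphism.Structures using (IsRingMonomorphism)
import Algebra.Morphism.RingMonomorphism as RingMonomorphism
import Algebra.Properties.CommutativeMonoid.Sum as CommutativeMonoidSum
import Algebra.Properties.Semiring.Sum as SemiringSum
import Algebra.Properties.Ring as RingProperties
import Algebra.Solver.Ring.NaturalCoefficients.Default as SemiringSolver
open import Data.Bool.Base using (if_then_else_)
open import Data.Empty using (⊥-elim)
open import Data.Fin.Base using (Fin; zero; suc; toℕ; _↑ˡ_; _↑ʳ_)
open import Data.Fin.Properties using (all?)
open import Data.Fin.Subset using (Subset; inside; outside; _∈_)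
open import Data.Fin.Subset.Properties using (_∈?_)
open import Data.Integer.Base as ℤ using (ℤ; +_)
open import Data.List.Base as List using (List; []; _∷_; applyUpTo; cartesianProductWith; filter)
import Data.List.Membership.DecPropositional as DecMembership
open import Data.Nat.Base as ℕ using (ℕ; zero; suc; _∸_; ⌊_/2⌋; ⌈_/2⌉)
import Data.Nat.Properties as ℕₚ
open import Data.Nat.Divisibility using (_∣?_)
open import Data.Product.Base using (_×_; _,_)
open import Data.Product.Properties using (≡-dec)
open import Data.Rational.Base as ℚ using (ℚ; 0ℚ; 1ℚ)
import Data.Rational.Properties as ℚₚ
open import Data.Sum.Base as Sum using (_⊎_; inj₁; inj₂)
import Data.Vec.Base as Vec
open import Data.Vec.Functional as Vector using (Vector)
open import Relation.Binary.Definitions using (Decidable)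
open import Relation.Binary.PropositionalEquality as ≡ using (_≡_)
import Relation.Binary.Reasoning.Setoid as SetoidReasoning
open import Relation.Nullary.Decidable using (Dec; yes; no; does; ¬?; _→-dec_; _⊎-dec_)
open import Relation.Nullary.Negation using (¬_)

record DecDomain c ℓ : Set (lsuc (c ⊔ ℓ)) where
  field
    commutativeRing : CommutativeRing c ℓ
  open CommutativeRing commutativeRing public
  infix 4 _≟_
  field
    _≟_             : Decidable _≈_
    1≉0             : ¬ (1# ≈ 0#)
    noZeroDivisors  : ∀ {x y} → x * y ≈ 0# → x ≈ 0# ⊎ y ≈ 0#

-- The inverse is total, with the convention 0⁻¹ = 0.
record DecField c ℓ : Set (lsuc (c ⊔ ℓ)) where
  field
    commutativeRing : CommutativeRing c ℓ
  open CommutativeRing commutativeRing public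
  infix 4 _≟_
  infix 8 _⁻¹
  field
    _≟_         : Decidable _≈_
    1≉0         : ¬ (1# ≈ 0#)
    _⁻¹         : Carrier → Carrier
    ⁻¹-inverse  : ∀ {x} → ¬ (x ≈ 0#) → x * x ⁻¹ ≈ 1#
    ⁻¹-zero     : ∀ {x} → x ≈ 0# → x ⁻¹ ≈ 0#

  infixl 7 _/_
  _/_ : Carrier → Carrier → Carrier
  x / y = x * y ⁻¹

ℚ-domain : DecDomain 0ℓ 0ℓ
ℚ-domain = record
  { commutativeRing = ℚₚ.+-*-commutativeRing
  ; _≟_             = ℚₚ._≟_
  ; 1≉0             = λ ()
  ; noZeroDivisors  = noZeroDivisors
  }
  where
  open ≡.≡-Reasoning

  noZeroDivisors : ∀ {p q} → p ℚ.* q ≡ 0ℚ → p ≡ 0ℚ ⊎ q ≡ 0ℚ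
  noZeroDivisors {p} {q} pq≡0 with p ℚₚ.≟ 0ℚ
  ... | yes p≡0 = inj₁ p≡0
  ... | no  p≢0 = inj₂ (begin
    q                        ≡⟨ ℚₚ.*-identityˡ q ⟨
    1ℚ ℚ.* q                 ≡⟨ ≡.cong (ℚ._* q) (ℚₚ.*-inverseˡ p) ⟨
    ((ℚ.1/ p) ℚ.* p) ℚ.* q   ≡⟨ ℚₚ.*-assoc (ℚ.1/ p) p q ⟩
    (ℚ.1/ p) ℚ.* (p ℚ.* q)   ≡⟨ ≡.cong ((ℚ.1/ p) ℚ.*_) pq≡0 ⟩
    (ℚ.1/ p) ℚ.* 0ℚ          ≡⟨ ℚₚ.*-zeroʳ (ℚ.1/ p) ⟩
    0ℚ                       ∎)
    where instance _ = ℚ.≢-nonZero p≢0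

module PowerSeries {c ℓ} (A : CommutativeRing c ℓ) where
  open CommutativeRing A
  open SemiringSum semiring
  open SemiringSolver commutativeSemiring using (solve; _:+_; _:*_; _:=_; con)
  open SetoidReasoning setoid

  Series : Set c
  Series = ℕ → Carrier

  infix  4 _≈ₛ_
  infixl 6 _+ₛ_
  infixl 7 _*ₛ_
  infix  8 -ₛ_

  _≈ₛ_ : Series → Series → Set ℓ
  f ≈ₛ g = ∀ n → f n ≈ g n

  _+ₛ_ _*ₛ_ : Series → Series → Series
  (f +ₛ g) n = f n + g n
  (f *ₛ g) n = ∑[ i ≤ n ] (f (toℕ i) * g (n ∸ toℕ i))

  -ₛ_ : Series → Series
  (-ₛ f) n = - f n

  const : Carrier → Series
  const a zero    = a
  const a (suc n) = 0#

  0ₛ 1ₛ t : Series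
  0ₛ n = 0#
  1ₛ   = const 1#
  t zero    = 0#
  t (suc n) = 1ₛ n

  private
    tl : Series → Series
    tl f n = f (suc n)

  *ₛ-cong : ∀ {f f′ g g′} → f ≈ₛ f′ → g ≈ₛ g′ → f *ₛ g ≈ₛ f′ *ₛ g′
  *ₛ-cong p q n = sum-cong-≋ {suc n} (λ i → *-cong (p (toℕ i)) (q (n ∸ toℕ i)))

  *ₛ-distribˡ : ∀ f g h → f *ₛ (g +ₛ h) ≈ₛ (f *ₛ g) +ₛ (f *ₛ h)
  *ₛ-distribˡ f g h n =
    trans (sum-cong-≋ {suc n} (λ i → distribˡ (f (toℕ i)) (g (n ∸ toℕ i)) (h (n ∸ toℕ i))))
          (∑-distrib-+ {suc n} (λ i → f (toℕ i) * g (n ∸ toℕ i)) (λ i → f (toℕ i) * h (n ∸ toℕ i)))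

  *ₛ-distribʳ : ∀ f g h → (g +ₛ h) *ₛ f ≈ₛ (g *ₛ f) +ₛ (h *ₛ f)
  *ₛ-distribʳ f g h n =
    trans (sum-cong-≋ {suc n} (λ i → distribʳ (f (n ∸ toℕ i)) (g (toℕ i)) (h (toℕ i))))
          (∑-distrib-+ {suc n} (λ i → g (toℕ i) * f (n ∸ toℕ i)) (λ i → h (toℕ i) * f (n ∸ toℕ i)))

  *ₛ-scale : ∀ a g h → (λ n → a * g n) *ₛ h ≈ₛ (λ n → a * (g *ₛ h) n)
  *ₛ-scale a g h n =
    trans (sum-cong-≋ {suc n} (λ i → *-assoc a (g (toℕ i)) (h (n ∸ toℕ i))))
          (sym (*-distribˡ-sum {suc n} a (λ i → g (toℕ i) * h (n ∸ toℕ i))))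

  *ₛ-zeroˡ : ∀ g → 0ₛ *ₛ g ≈ₛ 0ₛ
  *ₛ-zeroˡ g n =
    trans (sum-cong-≋ {suc n} (λ i → zeroˡ (g (n ∸ toℕ i)))) (sum-replicate-zero (suc n))

  *ₛ-suc : ∀ f g n → (f *ₛ g) (suc n) ≈ (f *ₛ tl g) n + f (suc n) * g 0
  *ₛ-suc f g zero    =
    solve 4 (λ a b c d → a :* b :+ (c :* d :+ con 0) := a :* b :+ con 0 :+ c :* d)
      refl (f 0) (g 1) (f 1) (g 0)
  *ₛ-suc f g (suc n) = trans (+-congˡ (*ₛ-suc (tl f) g n)) (sym (+-assoc _ _ _))

  *ₛ-comm : ∀ f g → f *ₛ g ≈ₛ g *ₛ f
  *ₛ-comm f g zero    = +-congʳ (*-comm (f 0) (g 0))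
  *ₛ-comm f g (suc n) = begin
    f 0 * g (suc n) + (tl f *ₛ g) n   ≈⟨ +-comm _ _ ⟩
    (tl f *ₛ g) n + f 0 * g (suc n)   ≈⟨ +-cong (*ₛ-comm (tl f) g n) (*-comm _ _) ⟩
    (g *ₛ tl f) n + g (suc n) * f 0   ≈⟨ *ₛ-suc g f n ⟨
    (g *ₛ f) (suc n)                  ∎

  *ₛ-assoc : ∀ f g h → (f *ₛ g) *ₛ h ≈ₛ f *ₛ (g *ₛ h)
  *ₛ-assoc f g h zero    =
    solve 3 (λ a b c → (a :* b :+ con 0) :* c :+ con 0 := a :* (b :* c :+ con 0) :+ con 0)
      refl (f 0) (g 0) (h 0)
  *ₛ-assoc f g h (suc n) = begin
    (f 0 * g 0 + 0#) * h (suc n) + (((λ k → f 0 * tl g k) +ₛ (tl f *ₛ g)) *ₛ h) n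
      ≈⟨ +-congˡ (*ₛ-distribʳ h (λ k → f 0 * tl g k) (tl f *ₛ g) n) ⟩
    (f 0 * g 0 + 0#) * h (suc n) + (((λ k → f 0 * tl g k) *ₛ h) n + ((tl f *ₛ g) *ₛ h) n)
      ≈⟨ +-congˡ (+-cong (*ₛ-scale (f 0) (tl g) h n) (*ₛ-assoc (tl f) g h n)) ⟩
    (f 0 * g 0 + 0#) * h (suc n) + (f 0 * (tl g *ₛ h) n + (tl f *ₛ (g *ₛ h)) n)
      ≈⟨ solve 5 (λ a b c d e →
           (a :* b :+ con 0) :* c :+ (a :* d :+ e) := a :* (b :* c :+ d) :+ e)
           refl (f 0) (g 0) (h (suc n)) ((tl g *ₛ h) n) ((tl f *ₛ (g *ₛ h)) n) ⟩
    f 0 * (g 0 * h (suc n) + (tl g *ₛ h) n) + (tl f *ₛ (g *ₛ h)) n ∎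

  *ₛ-identityˡ : ∀ g → 1ₛ *ₛ g ≈ₛ g
  *ₛ-identityˡ g zero    = trans (+-identityʳ _) (*-identityˡ _)
  *ₛ-identityˡ g (suc n) =
    trans (+-cong (*-identityˡ _) (*ₛ-zeroˡ g n)) (+-identityʳ _)

  series-commutativeRing : CommutativeRing c ℓ
  series-commutativeRing = record
    { Carrier = Series ; _≈_ = _≈ₛ_ ; _+_ = _+ₛ_ ; _*_ = _*ₛ_ ; -_ = -ₛ_ ; 0# = 0ₛ ; 1# = 1ₛ
    ; isCommutativeRing = record
      { isRing = record
        { +-isAbelianGroup = record
          { isGroup = record
            { isMonoid = record
              { isSemigroup = record
                { isMagma = record
                  { isEquivalence = record
                    { refl  = λ n → refl
                    ; sym   = λ p n → sym (p n)
                    ; trans = λ p q n → trans (p n) (q n)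
                    }
                  ; ∙-cong = λ p q n → +-cong (p n) (q n)
                  }
                ; assoc = λ f g h n → +-assoc (f n) (g n) (h n)
                }
              ; identity = (λ f n → +-identityˡ (f n)) , (λ f n → +-identityʳ (f n))
              }
            ; inverse = (λ f n → -‿inverseˡ (f n)) , (λ f n → -‿inverseʳ (f n))
            ; ⁻¹-cong = λ p n → -‿cong (p n)
            }
          ; comm = λ f g n → +-comm (f n) (g n)
          }
        ; *-cong     = *ₛ-cong
        ; *-assoc    = *ₛ-assoc
        ; *-identity = *ₛ-identityˡ , (λ f n → trans (*ₛ-comm f 1ₛ n) (*ₛ-identityˡ f n))
        ; distrib    = *ₛ-distribˡ , *ₛ-distribʳ
        }
      ; *-comm = *ₛ-comm
      }
    }

module PowerSeriesDivision {c ℓ} (K : DecField c ℓ) where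
  open DecField K
  open PowerSeries commutativeRing public
  open SemiringSum semiring
  open RingProperties ring using (-‿distribʳ-*)
  open SetoidReasoning setoid

  -- The coefficients g n , … , g 0 of g = 1 / f, obtained by solving f * g = 1
  -- for the successive coefficients of g.
  reciprocals : Series → ∀ n → Vector Carrier (suc n)
  reciprocals f zero    = f 0 ⁻¹ Vector.∷ Vector.[]
  reciprocals f (suc n) =
    - (f 0 ⁻¹ * (∑[ i ≤ n ] (f (suc (toℕ i)) * reciprocals f n i))) Vector.∷ reciprocals f n

  infix 8 _⁻¹ₛ
  _⁻¹ₛ : Series → Series
  (f ⁻¹ₛ) n = Vector.head (reciprocals f n)

  infixl 7 _/ₛ_
  _/ₛ_ : Series → Series → Series
  f /ₛ g = f *ₛ g ⁻¹ₛ

  reciprocals-lookup : ∀ f n i → reciprocals f n i ≡ (f ⁻¹ₛ) (n ∸ toℕ i)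
  reciprocals-lookup f zero    zero    = ≡.refl
  reciprocals-lookup f (suc n) zero    = ≡.refl
  reciprocals-lookup f (suc n) (suc i) = reciprocals-lookup f n i

  ⁻¹ₛ-inverse : ∀ f → ¬ (f 0 ≈ 0#) → f *ₛ f ⁻¹ₛ ≈ₛ 1ₛ
  ⁻¹ₛ-inverse f f₀≉0 zero    = trans (+-identityʳ _) (⁻¹-inverse f₀≉0)
  ⁻¹ₛ-inverse f f₀≉0 (suc n) = begin
    f 0 * - (f 0 ⁻¹ * s) + s′     ≈⟨ +-congʳ (-‿distribʳ-* (f 0) (f 0 ⁻¹ * s)) ⟨
    - (f 0 * (f 0 ⁻¹ * s)) + s′   ≈⟨ +-congʳ (-‿cong (*-assoc (f 0) (f 0 ⁻¹) s)) ⟨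
    - (f 0 * f 0 ⁻¹ * s) + s′     ≈⟨ +-congʳ (-‿cong (*-congʳ (⁻¹-inverse f₀≉0))) ⟩
    - (1# * s) + s′               ≈⟨ +-congʳ (-‿cong (*-identityˡ s)) ⟩
    - s + s′                      ≈⟨ +-congˡ s≈s′ ⟨
    - s + s                       ≈⟨ -‿inverseˡ s ⟩
    0#                            ∎
    where
    s s′ : Carrier
    s  = ∑[ i ≤ n ] (f (suc (toℕ i)) * reciprocals f n i)
    s′ = ∑[ i ≤ n ] (f (suc (toℕ i)) * (f ⁻¹ₛ) (n ∸ toℕ i))

    s≈s′ : s ≈ s′
    s≈s′ = sum-cong-≋ {suc n} (λ i →
      *-congˡ {f (suc (toℕ i))} (reflexive (reciprocals-lookup f n i)))

-- Polynomials over D are coefficient lists, constant coefficient first, up to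
-- trailing zeros.
module Polynomial {c ℓ} (D : DecDomain c ℓ) where
  open DecDomain D
  open PowerSeries commutativeRing hiding (const)
  open RingProperties ring using (-0#≈0#)

  Poly : Set c
  Poly = List Carrier

  coeff : Poly → ℕ → Carrier
  coeff []      n       = 0#
  coeff (a ∷ p) zero    = a
  coeff (a ∷ p) (suc n) = coeff p n

  infix  4 _≈ₚ_ _≟ₚ_
  infixl 6 _+ₚ_
  infixl 7 _*ₚ_

  _≈ₚ_ : Poly → Poly → Set ℓ
  p ≈ₚ q = ∀ n → coeff p n ≈ coeff q n

  _+ₚ_ _*ₚ_ : Poly → Poly → Poly
  []      +ₚ q       = q
  (a ∷ p) +ₚ []      = a ∷ p
  (a ∷ p) +ₚ (b ∷ q) = (a + b) ∷ (p +ₚ q)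

  []      *ₚ q = []
  (a ∷ p) *ₚ q = List.map (a *_) q +ₚ (0# ∷ (p *ₚ q))

  -ₚ_ : Poly → Poly
  -ₚ_ = List.map (-_)

  const : Carrier → Poly
  const a = a ∷ []

  0ₚ 1ₚ x : Poly
  0ₚ = []
  1ₚ = const 1#
  x  = 0# ∷ 1# ∷ []

  coeff-+ : ∀ p q → coeff (p +ₚ q) ≈ₛ coeff p +ₛ coeff q
  coeff-+ []      q       n       = sym (+-identityˡ _)
  coeff-+ (a ∷ p) []      n       = sym (+-identityʳ _)
  coeff-+ (a ∷ p) (b ∷ q) zero    = refl
  coeff-+ (a ∷ p) (b ∷ q) (suc n) = coeff-+ p q n

  coeff-scale : ∀ a p n → coeff (List.map (a *_) p) n ≈ a * coeff p n
  coeff-scale a []      n       = sym (zeroʳ a)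
  coeff-scale a (b ∷ p) zero    = refl
  coeff-scale a (b ∷ p) (suc n) = coeff-scale a p n

  coeff-- : ∀ p → coeff (-ₚ p) ≈ₛ -ₛ coeff p
  coeff-- []      n       = sym -0#≈0#
  coeff-- (a ∷ p) zero    = refl
  coeff-- (a ∷ p) (suc n) = coeff-- p n

  coeff-* : ∀ p q → coeff (p *ₚ q) ≈ₛ coeff p *ₛ coeff q
  coeff-* []      q n       = sym (*ₛ-zeroˡ (coeff q) n)
  coeff-* (a ∷ p) q zero    =
    trans (coeff-+ (List.map (a *_) q) (0# ∷ (p *ₚ q)) 0) (+-congʳ (coeff-scale a q 0))
  coeff-* (a ∷ p) q (suc n) =
    trans (coeff-+ (List.map (a *_) q) (0# ∷ (p *ₚ q)) (suc n))
          (+-cong (coeff-scale a q (suc n)) (coeff-* p q n))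

  coeff-1 : coeff 1ₚ ≈ₛ 1ₛ
  coeff-1 zero    = refl
  coeff-1 (suc n) = refl

  poly-rawRing : RawRing c ℓ
  poly-rawRing = record
    { Carrier = Poly ; _≈_ = _≈ₚ_ ; _+_ = _+ₚ_ ; _*_ = _*ₚ_ ; -_ = -ₚ_ ; 0# = 0ₚ ; 1# = 1ₚ }

  coeff-isRingMonomorphism :
    IsRingMonomorphism poly-rawRing (CommutativeRing.rawRing series-commutativeRing) coeff
  coeff-isRingMonomorphism = record
    { isRingHomomorphism = record
      { isSemiringHomomorphism = record
        { isNearSemiringHomomorphism = record
          { +-isMonoidHomomorphism = record
            { isMagmaHomomorphism = record
              { isRelHomomorphism = record { cong = λ p → p }
              ; homo = coeff-+
              }
            ; ε-homo = λ n → refl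
            }
          ; *-homo = coeff-*
          }
        ; 1#-homo = coeff-1
        }
      ; -‿homo = coeff--
      }
    ; injective = λ p → p
    }

  poly-commutativeRing : CommutativeRing c ℓ
  poly-commutativeRing = record
    { isCommutativeRing = RingMonomorphism.isCommutativeRing coeff-isRingMonomorphism
        (CommutativeRing.isCommutativeRing series-commutativeRing) }

  _≟ₚ_ : Decidable _≈ₚ_
  []      ≟ₚ []      = yes (λ n → refl)
  []      ≟ₚ (b ∷ q) with 0# ≟ b | [] ≟ₚ q
  ... | yes h | yes k = yes λ { zero → h ; (suc n) → k n }
  ... | no ¬h | _     = no λ e → ¬h (e 0)
  ... | _     | no ¬k = no λ e → ¬k (λ n → e (suc n))
  (a ∷ p) ≟ₚ []      with a ≟ 0# | p ≟ₚ []
  ... | yes h | yes k = yes λ { zero → h ; (suc n) → k n }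
  ... | no ¬h | _     = no λ e → ¬h (e 0)
  ... | _     | no ¬k = no λ e → ¬k (λ n → e (suc n))
  (a ∷ p) ≟ₚ (b ∷ q) with a ≟ b | p ≟ₚ q
  ... | yes h | yes k = yes λ { zero → h ; (suc n) → k n }
  ... | no ¬h | _     = no λ e → ¬h (e 0)
  ... | _     | no ¬k = no λ e → ¬k (λ n → e (suc n))

  private
    zero-∷ : ∀ {a p} → a ≈ 0# → p ≈ₚ 0ₚ → (a ∷ p) ≈ₚ 0ₚ
    zero-∷ h k zero    = h
    zero-∷ h k (suc n) = k n

    ZeroProduct : Poly → Poly → Set ℓ
    ZeroProduct p q = coeff p *ₛ coeff q ≈ₛ 0ₛ → p ≈ₚ 0ₚ ⊎ q ≈ₚ 0ₚ

    zeroProduct-∷ : ∀ a p b q → ZeroProduct p (b ∷ q) → ZeroProduct (a ∷ p) q →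
                    ZeroProduct (a ∷ p) (b ∷ q)
    zeroProduct-∷ a p b q rec₁ rec₂ e with a ≟ 0# | b ≟ 0#
    ... | yes a≈0 | _       = Sum.map₁ (zero-∷ a≈0) (rec₁ (λ n →
      trans (sym (trans (+-congʳ (trans (*-congʳ a≈0) (zeroˡ _))) (+-identityˡ _)))
            (e (suc n))))
    ... | no _    | yes b≈0 = Sum.map₂ (zero-∷ b≈0) (rec₂ (λ n →
      trans (sym (trans (*ₛ-suc (coeff (a ∷ p)) (coeff (b ∷ q)) n)
                        (trans (+-congˡ (trans (*-congˡ b≈0) (zeroʳ _))) (+-identityʳ _))))
            (e (suc n))))
    ... | no a≉0  | no b≉0  = ⊥-elim
      (Sum.[ a≉0 , b≉0 ] (noZeroDivisors (trans (sym (+-identityʳ (a * b))) (e 0))))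

    zeroProduct : ∀ p q → ZeroProduct p q
    zeroProduct []      q       e = inj₁ (λ n → refl)
    zeroProduct (a ∷ p) []      e = inj₂ (λ n → refl)
    zeroProduct (a ∷ p) (b ∷ q)   =
      zeroProduct-∷ a p b q (zeroProduct p (b ∷ q)) (zeroProduct (a ∷ p) q)

  poly-domain : DecDomain c ℓ
  poly-domain = record
    { commutativeRing = poly-commutativeRing
    ; _≟_             = _≟ₚ_
    ; 1≉0             = λ e → 1≉0 (e 0)
    ; noZeroDivisors  = λ {p} {q} e →
        zeroProduct p q (λ n → trans (sym (coeff-* p q n)) (e n))
    }

module FractionField {c ℓ} (D : DecDomain c ℓ) where
  open DecDomain D
  open RingProperties ring using (-‿distribˡ-*; x∙y⁻¹≈ε⇒x≈y)
  open SemiringSolver commutativeSemiring using (solve; _:+_; _:*_; _:=_; con)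
  open SetoidReasoning setoid

  infix 5 _÷_[_]
  record Fraction : Set (c ⊔ ℓ) where
    constructor _÷_[_]
    field
      num   : Carrier
      den   : Carrier
      den≉0 : ¬ (den ≈ 0#)
  open Fraction public

  infix 4 _≈ᶠ_
  record _≈ᶠ_ (u v : Fraction) : Set ℓ where
    constructor cross
    field
      cross-eq : num u * den v ≈ num v * den u
  open _≈ᶠ_ public

  *-nonzero : ∀ {a b} → ¬ (a ≈ 0#) → ¬ (b ≈ 0#) → ¬ (a * b ≈ 0#)
  *-nonzero a≉0 b≉0 e with noZeroDivisors e
  ... | inj₁ h = a≉0 h
  ... | inj₂ h = b≉0 h

  *-cancelʳ : ∀ {a b d} → ¬ (d ≈ 0#) → a * d ≈ b * d → a ≈ b
  *-cancelʳ {a} {b} {d} d≉0 e with noZeroDivisors {a - b} {d} (begin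
      (a - b) * d       ≈⟨ distribʳ d a (- b) ⟩
      a * d + - b * d   ≈⟨ +-congˡ (-‿distribˡ-* b d) ⟨
      a * d - b * d     ≈⟨ +-congʳ e ⟩
      b * d - b * d     ≈⟨ -‿inverseʳ (b * d) ⟩
      0#                ∎)
  ... | inj₁ h = x∙y⁻¹≈ε⇒x≈y a b h
  ... | inj₂ h = ⊥-elim (d≉0 h)

  fromDomain : Carrier → Fraction
  fromDomain a = a ÷ 1# [ 1≉0 ]

  infixl 6 _+ᶠ_
  infixl 7 _*ᶠ_
  infix  8 _⁻¹ᶠ

  _+ᶠ_ _*ᶠ_ : Fraction → Fraction → Fraction
  (a ÷ b [ p ]) +ᶠ (c ÷ d [ q ]) = (a * d + c * b) ÷ (b * d) [ *-nonzero p q ]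
  (a ÷ b [ p ]) *ᶠ (c ÷ d [ q ]) = (a * c) ÷ (b * d) [ *-nonzero p q ]

  -ᶠ_ : Fraction → Fraction
  -ᶠ (a ÷ b [ p ]) = (- a) ÷ b [ p ]

  0ᶠ 1ᶠ : Fraction
  0ᶠ = fromDomain 0#
  1ᶠ = fromDomain 1#

  _⁻¹ᶠ : Fraction → Fraction
  (a ÷ b [ p ]) ⁻¹ᶠ with a ≟ 0#
  ... | yes _  = 0ᶠ
  ... | no a≉0 = b ÷ a [ a≉0 ]

  ≈ᶠ-refl : ∀ {u} → u ≈ᶠ u
  ≈ᶠ-refl = cross refl

  ≈ᶠ-sym : ∀ {u v} → u ≈ᶠ v → v ≈ᶠ u
  ≈ᶠ-sym (cross e) = cross (sym e)

  ≈ᶠ-trans : ∀ {u v w} → u ≈ᶠ v → v ≈ᶠ w → u ≈ᶠ w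
  ≈ᶠ-trans {a ÷ b [ _ ]} {c ÷ d [ q ]} {e ÷ f [ _ ]} (cross h) (cross k) =
    cross (*-cancelʳ q (begin
      a * f * d   ≈⟨ solve 3 (λ a f d → a :* f :* d := a :* d :* f) refl a f d ⟩
      a * d * f   ≈⟨ *-congʳ h ⟩
      c * b * f   ≈⟨ solve 3 (λ c b f → c :* b :* f := c :* f :* b) refl c b f ⟩
      c * f * b   ≈⟨ *-congʳ k ⟩
      e * d * b   ≈⟨ solve 3 (λ e d b → e :* d :* b := e :* b :* d) refl e d b ⟩
      e * b * d   ∎))

  +ᶠ-cong : ∀ {u u′ v v′} → u ≈ᶠ u′ → v ≈ᶠ v′ → u +ᶠ v ≈ᶠ u′ +ᶠ v′
  +ᶠ-cong {a ÷ b [ _ ]} {a′ ÷ b′ [ _ ]} {c ÷ d [ _ ]} {c′ ÷ d′ [ _ ]} (cross h) (cross k) =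
    cross (begin
      (a * d + c * b) * (b′ * d′)
        ≈⟨ solve 6 (λ a b c d b′ d′ → (a :* d :+ c :* b) :* (b′ :* d′)
             := a :* b′ :* (d :* d′) :+ c :* d′ :* (b :* b′)) refl a b c d b′ d′ ⟩
      a * b′ * (d * d′) + c * d′ * (b * b′)
        ≈⟨ +-cong (*-congʳ h) (*-congʳ k) ⟩
      a′ * b * (d * d′) + c′ * d * (b * b′)
        ≈⟨ solve 6 (λ a′ b c′ d b′ d′ → a′ :* b :* (d :* d′) :+ c′ :* d :* (b :* b′)
             := (a′ :* d′ :+ c′ :* b′) :* (b :* d)) refl a′ b c′ d b′ d′ ⟩
      (a′ * d′ + c′ * b′) * (b * d) ∎)

  *ᶠ-cong : ∀ {u u′ v v′} → u ≈ᶠ u′ → v ≈ᶠ v′ → u *ᶠ v ≈ᶠ u′ *ᶠ v′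
  *ᶠ-cong {a ÷ b [ _ ]} {a′ ÷ b′ [ _ ]} {c ÷ d [ _ ]} {c′ ÷ d′ [ _ ]} (cross h) (cross k) =
    cross (begin
      a * c * (b′ * d′)
        ≈⟨ solve 4 (λ a c b′ d′ → a :* c :* (b′ :* d′) := a :* b′ :* (c :* d′)) refl a c b′ d′ ⟩
      a * b′ * (c * d′)
        ≈⟨ *-cong h k ⟩
      a′ * b * (c′ * d)
        ≈⟨ solve 4 (λ a′ b c′ d → a′ :* b :* (c′ :* d) := a′ :* c′ :* (b :* d)) refl a′ b c′ d ⟩
      a′ * c′ * (b * d) ∎)

  -ᶠ-cong : ∀ {u v} → u ≈ᶠ v → -ᶠ u ≈ᶠ -ᶠ v
  -ᶠ-cong {a ÷ b [ _ ]} {c ÷ d [ _ ]} (cross h) =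
    cross (trans (sym (-‿distribˡ-* a d)) (trans (-‿cong h) (-‿distribˡ-* c b)))

  +ᶠ-assoc : ∀ u v w → (u +ᶠ v) +ᶠ w ≈ᶠ u +ᶠ (v +ᶠ w)
  +ᶠ-assoc (a ÷ b [ _ ]) (c ÷ d [ _ ]) (e ÷ f [ _ ]) = cross
    (solve 6 (λ a b c d e f →
      ((a :* d :+ c :* b) :* f :+ e :* (b :* d)) :* (b :* (d :* f))
      := (a :* (d :* f) :+ (c :* f :+ e :* d) :* b) :* ((b :* d) :* f)) refl a b c d e f)

  +ᶠ-comm : ∀ u v → u +ᶠ v ≈ᶠ v +ᶠ u
  +ᶠ-comm (a ÷ b [ _ ]) (c ÷ d [ _ ]) = cross
    (solve 4 (λ a b c d → (a :* d :+ c :* b) :* (d :* b) := (c :* b :+ a :* d) :* (b :* d))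
      refl a b c d)

  +ᶠ-identityˡ : ∀ u → 0ᶠ +ᶠ u ≈ᶠ u
  +ᶠ-identityˡ (a ÷ b [ _ ]) = cross
    (solve 2 (λ a b → (con 0 :* b :+ a :* con 1) :* b := a :* (con 1 :* b)) refl a b)

  -ᶠ-inverseˡ : ∀ u → (-ᶠ u) +ᶠ u ≈ᶠ 0ᶠ
  -ᶠ-inverseˡ (a ÷ b [ _ ]) = cross (begin
    (- a * b + a * b) * 1#   ≈⟨ *-identityʳ _ ⟩
    - a * b + a * b          ≈⟨ distribʳ b (- a) a ⟨
    (- a + a) * b            ≈⟨ *-congʳ (-‿inverseˡ a) ⟩
    0# * b                   ≈⟨ zeroˡ b ⟩
    0#                       ≈⟨ zeroˡ (b * b) ⟨
    0# * (b * b)             ∎)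

  *ᶠ-assoc : ∀ u v w → (u *ᶠ v) *ᶠ w ≈ᶠ u *ᶠ (v *ᶠ w)
  *ᶠ-assoc (a ÷ b [ _ ]) (c ÷ d [ _ ]) (e ÷ f [ _ ]) = cross
    (*-cong (*-assoc a c e) (sym (*-assoc b d f)))

  *ᶠ-comm : ∀ u v → u *ᶠ v ≈ᶠ v *ᶠ u
  *ᶠ-comm (a ÷ b [ _ ]) (c ÷ d [ _ ]) = cross (*-cong (*-comm a c) (*-comm d b))

  *ᶠ-identityˡ : ∀ u → 1ᶠ *ᶠ u ≈ᶠ u
  *ᶠ-identityˡ (a ÷ b [ _ ]) = cross
    (solve 2 (λ a b → con 1 :* a :* b := a :* (con 1 :* b)) refl a b)

  *ᶠ-distribˡ : ∀ u v w → u *ᶠ (v +ᶠ w) ≈ᶠ (u *ᶠ v) +ᶠ (u *ᶠ w)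
  *ᶠ-distribˡ (a ÷ b [ _ ]) (c ÷ d [ _ ]) (e ÷ f [ _ ]) = cross
    (solve 6 (λ a b c d e f →
      a :* (c :* f :+ e :* d) :* ((b :* d) :* (b :* f))
      := (a :* c :* (b :* f) :+ a :* e :* (b :* d)) :* (b :* (d :* f))) refl a b c d e f)

  fraction-commutativeRing : CommutativeRing (c ⊔ ℓ) ℓ
  fraction-commutativeRing = record
    { Carrier = Fraction ; _≈_ = _≈ᶠ_ ; _+_ = _+ᶠ_ ; _*_ = _*ᶠ_ ; -_ = -ᶠ_ ; 0# = 0ᶠ ; 1# = 1ᶠ
    ; isCommutativeRing = record
      { isRing = record
        { +-isAbelianGroup = record
          { isGroup = record
            { isMonoid = record
              { isSemigroup = record
                { isMagma = record
                  { isEquivalence = record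
                    { refl = ≈ᶠ-refl ; sym = ≈ᶠ-sym ; trans = ≈ᶠ-trans }
                  ; ∙-cong = +ᶠ-cong
                  }
                ; assoc = +ᶠ-assoc
                }
              ; identity = +ᶠ-identityˡ
                         , (λ u → ≈ᶠ-trans (+ᶠ-comm u 0ᶠ) (+ᶠ-identityˡ u))
              }
            ; inverse = -ᶠ-inverseˡ
                      , (λ u → ≈ᶠ-trans (+ᶠ-comm u (-ᶠ u)) (-ᶠ-inverseˡ u))
            ; ⁻¹-cong = -ᶠ-cong
            }
          ; comm = +ᶠ-comm
          }
        ; *-cong     = *ᶠ-cong
        ; *-assoc    = *ᶠ-assoc
        ; *-identity = *ᶠ-identityˡ
                     , (λ u → ≈ᶠ-trans (*ᶠ-comm u 1ᶠ) (*ᶠ-identityˡ u))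
        ; distrib    = *ᶠ-distribˡ
                     , (λ u v w → ≈ᶠ-trans (*ᶠ-comm (v +ᶠ w) u)
                         (≈ᶠ-trans (*ᶠ-distribˡ u v w) (+ᶠ-cong (*ᶠ-comm u v) (*ᶠ-comm u w))))
        }
      ; *-comm = *ᶠ-comm
      }
    }

  ≈ᶠ0⇒num≈0 : ∀ {u} → u ≈ᶠ 0ᶠ → num u ≈ 0#
  ≈ᶠ0⇒num≈0 (cross e) = trans (sym (*-identityʳ _)) (trans e (zeroˡ _))

  num≈0⇒≈ᶠ0 : ∀ {u} → num u ≈ 0# → u ≈ᶠ 0ᶠ
  num≈0⇒≈ᶠ0 e = cross (trans (*-identityʳ _) (trans e (sym (zeroˡ _))))

  ⁻¹ᶠ-inverse : ∀ {u} → ¬ (u ≈ᶠ 0ᶠ) → u *ᶠ (u ⁻¹ᶠ) ≈ᶠ 1ᶠ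
  ⁻¹ᶠ-inverse {a ÷ b [ _ ]} u≉0 with a ≟ 0#
  ... | yes a≈0 = ⊥-elim (u≉0 (num≈0⇒≈ᶠ0 a≈0))
  ... | no  _   = cross (solve 2 (λ a b → a :* b :* con 1 := con 1 :* (b :* a)) refl a b)

  ⁻¹ᶠ-zero : ∀ {u} → u ≈ᶠ 0ᶠ → u ⁻¹ᶠ ≈ᶠ 0ᶠ
  ⁻¹ᶠ-zero {a ÷ b [ _ ]} u≈0 with a ≟ 0#
  ... | yes _  = ≈ᶠ-refl
  ... | no a≉0 = ⊥-elim (a≉0 (≈ᶠ0⇒num≈0 u≈0))

  infix 4 _≟ᶠ_
  _≟ᶠ_ : Decidable _≈ᶠ_
  u ≟ᶠ v with num u * den v ≟ num v * den u
  ... | yes e = yes (cross e)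
  ... | no ¬e = no (λ { (cross e) → ¬e e })

  fraction-field : DecField (c ⊔ ℓ) ℓ
  fraction-field = record
    { commutativeRing = fraction-commutativeRing
    ; _≟_             = _≟ᶠ_
    ; 1≉0             = λ e → 1≉0 (≈ᶠ0⇒num≈0 e)
    ; _⁻¹             = _⁻¹ᶠ
    ; ⁻¹-inverse      = ⁻¹ᶠ-inverse
    ; ⁻¹-zero         = ⁻¹ᶠ-zero
    }

-- The rational function field ℚ(x₀ , … , xₙ₋₁), as the fraction field of the
-- iterated polynomial ring ℚ[xₙ₋₁]⋯[x₀].
polynomials : ℕ → DecDomain 0ℓ 0ℓ
polynomials zero    = ℚ-domain
polynomials (suc n) = Polynomial.poly-domain (polynomials n)

variable′ : ∀ {n} → Fin n → DecDomain.Carrier (polynomials n)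
variable′ {suc n} zero    = Polynomial.x (polynomials n)
variable′ {suc n} (suc i) = Polynomial.const (polynomials n) (variable′ i)

rationalFunctions : ℕ → DecField 0ℓ 0ℓ
rationalFunctions n = FractionField.fraction-field (polynomials n)

indeterminate : ∀ {n} → Fin n → DecField.Carrier (rationalFunctions n)
indeterminate {n} i = FractionField.fromDomain (polynomials n) (variable′ i)

-- The first r of the 2r indeterminates are R₁₀ , … , Rᵣ₀, the last r are
-- R₁₁ , … , Rᵣ₁.
module QSystem (r : ℕ) where

  K : DecField 0ℓ 0ℓ
  K = rationalFunctions (r ℕ.+ r)

  open DecField K

  -- R α n is R_{α,n}; only the values with α ≤ r + 1 are constrained.
  record IsQSystem (R : ℕ → ℤ → Carrier) : Set where
    field
      nonzero    : ∀ α n → α ℕ.≤ suc r → ¬ (R α n ≈ 0#)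
      initial₀   : ∀ (i : Fin r) → R (suc (toℕ i)) (+ 0) ≈ indeterminate (i ↑ˡ r)
      initial₁   : ∀ (i : Fin r) → R (suc (toℕ i)) (+ 1) ≈ indeterminate (r ↑ʳ i)
      boundary₀  : ∀ n → R 0 n ≈ 1#
      boundary₁  : ∀ n → R (suc r) n ≈ 1#
      recurrence : ∀ α n → 1 ℕ.≤ α → α ℕ.≤ r →
        R α (n ℤ.+ + 1) * R α (n ℤ.- + 1) ≈ R α n * R α n + R (α ℕ.+ 1) n * R (α ∸ 1) n

  module Weights (R : ℕ → ℤ → Carrier) where

    y-odd y-even : ℕ → Carrier
    y-odd  α = (R (α ∸ 1) (+ 0) * R α (+ 1)) / (R α (+ 0) * R (α ∸ 1) (+ 1))
    y-even α = (R (α ∸ 1) (+ 0) * R (α ℕ.+ 1) (+ 1)) / (R α (+ 0) * R α (+ 1))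

    -- y (2α - 1) = y-odd α and y (2α) = y-even α
    y : ℕ → Carrier
    y v = if does (2 ∣? v) then y-even ⌊ v /2⌋ else y-odd ⌈ v /2⌉

module HardParticles (r : ℕ) where

  Vertex : Set
  Vertex = Fin (suc (2 ℕ.* r))

  label : Vertex → ℕ
  label i = suc (toℕ i)

  -- The index j of applyUpTo starts at 0, so k runs over 1 , … , r in the
  -- second family and over 2 , … , r in the last two.
  edges : List (ℕ × ℕ)
  edges = (1 , 2)
        ∷ applyUpTo (λ j → let k = j ℕ.+ 1 in 2 ℕ.* k , 2 ℕ.* k ℕ.+ 1) r
   List.++ applyUpTo (λ j → let k = j ℕ.+ 2 in 2 ℕ.* k ∸ 2 , 2 ℕ.* k) (r ∸ 1)
   List.++ applyUpTo (λ j → let k = j ℕ.+ 2 in 2 ℕ.* k ∸ 1 , 2 ℕ.* k) (r ∸ 1)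

  private
    open module Membership = DecMembership (≡-dec ℕₚ._≟_ ℕₚ._≟_)
      using () renaming (_∈_ to _∈ₗ_; _∈?_ to _∈ₗ?_)

  Adjacent : Vertex → Vertex → Set
  Adjacent i j = (label i , label j) ∈ₗ edges ⊎ (label j , label i) ∈ₗ edges

  adjacent? : Decidable Adjacent
  adjacent? i j = ((label i , label j) ∈ₗ? edges) ⊎-dec ((label j , label i) ∈ₗ? edges)

  HardConfiguration : Subset (suc (2 ℕ.* r)) → Set
  HardConfiguration C = ∀ i j → i ∈ C → j ∈ C → ¬ Adjacent i j

  hardConfiguration? : ∀ C → Dec (HardConfiguration C)
  hardConfiguration? C =
    all? (λ i → all? (λ j → (i ∈? C) →-dec ((j ∈? C) →-dec ¬? (adjacent? i j))))

  subsets : ∀ n → List (Subset n)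
  subsets zero    = Vec.[] ∷ []
  subsets (suc n) = cartesianProductWith Vec._∷_ (outside ∷ inside ∷ []) (subsets n)

  configurations : List (Subset (suc (2 ℕ.* r)))
  configurations = filter hardConfiguration? (subsets (suc (2 ℕ.* r)))

  module PartitionFunction {c ℓ} (A : CommutativeRing c ℓ) where
    open CommutativeRing A
    open CommutativeMonoidSum *-commutativeMonoid using () renaming (sum to product)

    weight : Vector Carrier (suc (2 ℕ.* r)) → Subset (suc (2 ℕ.* r)) → Carrier
    weight z C = product (λ i → if Vec.lookup C i then z i else 1#)

    Z : Vector Carrier (suc (2 ℕ.* r)) → Carrier
    Z z = List.foldr _+_ 0# (List.map (weight z) configurations)

module GeneratingFunction (r : ℕ) (R : ℕ → ℤ → DecField.Carrier (QSystem.K r)) where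
  open QSystem r public
  open Weights R public
  open PowerSeriesDivision K public
  open HardParticles r public
  open PartitionFunction series-commutativeRing public

  ∑R₁ₙtⁿ : Series
  ∑R₁ₙtⁿ n = R 1 (+ n)

  -ty : Vector Series (suc (2 ℕ.* r))
  -ty i = -ₛ (t *ₛ const (y (label i)))

{-# OPTIONS --safe #-}
-- Let y⁽ⁿ⁾ be the weights with the times 0, 1 replaced by n, n + 1, and write
-- y = y⁽ⁿ⁾, y′ = y⁽ⁿ⁺¹⁾. The Q-system becomes a quotient-difference scheme: with
-- S_k = y_{2k-1} + y_{2k} (and S_{r+1} = y_{2r+1}),
--   y′_1 = S_1,  y′_{2k} S_k = y_{2k} S_{k+1},  y′_{2k+1} S_k = y_{2k-1} S_{k+1}.
-- Let B_k and A_k be the partition functions, at weights -t y, of the vertices from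
-- 2k + 1 and from 2k on; they satisfy
--   B_k = A_{k+1} - t y_{2k+1} B_{k+1},  A_k = B_k - t y_{2k} B_{k+1}.
-- Downward induction on k gives S_k B′_k = y_{2k-1} B_k + y_{2k} B_{k+1} and
-- A′_k = B_k. Hence the denominator D = B_0 does not depend on n, and as
-- R_{1,n} y_1 = R_{1,n+1}, the quotients G_n = R_{1,n} A_1 / D satisfy
-- G_n = R_{1,n} + t G_{n+1}, which determines the coefficients of G_0.
module Submission where

open import Defs
open import Algebra.Bundles using (CommutativeRing)
import Algebra.Properties.CommutativeMonoid.Sum as CommutativeMonoidSum
import Algebra.Properties.Ring as RingProperties
import Algebra.Solver.Ring.NaturalCoefficients.Default as SemiringSolver
open import Data.Bool.Base using (Bool; true; false; not; if_then_else_; _∧_; T)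
open import Data.Bool.Properties using (T?)
open import Data.Fin.Base using (zero; suc; toℕ)
open import Data.Fin.Properties using (toℕ<n)
open import Data.Fin.Subset using (Subset; inside; outside; _∈_)
open import Data.Fin.Subset.Properties using (drop-there)
open import Data.Integer.Base using (ℤ; +_)
open import Data.List.Base as List using (List; []; _++_; applyUpTo)
import Data.List.Membership.Propositional as List
open import Data.List.Membership.Propositional.Properties using (∈-++⁺ˡ; ∈-++⁺ʳ; ∈-++⁻; ∈-applyUpTo⁺; ∈-applyUpTo⁻)
open import Data.List.Properties using (++-identityʳ)
open import Data.List.Relation.Unary.Any using (here; there)
open import Data.Nat.Base as ℕ using (ℕ; zero; suc; _≤_; _<_; _∸_; z≤n; s≤s; s≤s⁻¹; ⌊_/2⌋)
import Data.Nat.Properties as ℕₚ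
open import Data.Nat.Divisibility using (_∣_; _∣?_; divides)
open import Data.Product.Base using (_×_; _,_; proj₁; proj₂)
open import Data.Sum.Base using (inj₁; inj₂)
open import Data.Unit.Base using (tt)
import Data.Vec.Base as Vec
open import Data.Vec.Functional using (Vector; _∷_; tail)
open import Function.Base using (_∘_)
open import Function.Bundles using (_⇔_; mk⇔; Equivalence)
open import Level using (_⊔_)
open import Relation.Binary.PropositionalEquality as ≡ using (_≡_; _≢_)
import Relation.Binary.Reasoning.Setoid as SetoidReasoning
open import Relation.Nullary.Decidable using (does; does-⇔; dec-true; dec-false)
open import Relation.Nullary.Negation using (¬_)
open import Relation.Unary using (Pred; Decidable)

-- Parity arithmetic and the edges of Gᵣ

-- Unlike `2 ℕ.* n`, this reduces to two successors, so positions can be peeled off in pairs by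
-- computation.
double : ℕ → ℕ
double zero    = zero
double (suc n) = suc (suc (double n))

2*≡double : ∀ n → 2 ℕ.* n ≡ double n
2*≡double zero    = ≡.refl
2*≡double (suc n) =
  ≡.cong suc (≡.trans (ℕₚ.+-suc n (n ℕ.+ 0)) (≡.cong suc (2*≡double n)))

double-cancel-≤ : ∀ {m n} → double m ≤ double n → m ≤ n
double-cancel-≤ {zero}          le             = z≤n
double-cancel-≤ {suc m} {suc n} (s≤s (s≤s le)) = s≤s (double-cancel-≤ le)

double-cancel-< : ∀ {m n} → double m < double n → m < n
double-cancel-< {zero}  {suc n} lt             = s≤s z≤n
double-cancel-< {suc m} {suc n} (s≤s (s≤s lt)) = s≤s (double-cancel-< lt)

shift : ∀ {a} {X : Set a} → (ℕ → X) → ℕ → X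
shift f k = f (suc k)

data Parity : ℕ → Set where
  even : ∀ q → Parity (double q)
  odd  : ∀ q → Parity (suc (double q))

parity : ∀ n → Parity n
parity zero          = even 0
parity (suc zero)    = odd 0
parity (suc (suc n)) with parity n
... | even q = even (suc q)
... | odd q  = odd (suc q)

-- Positions count from 0; the flag e tells whether position 0 carries an even
-- label, so that Gᵣ itself (labels from 1) has e = false.
evenLabel : Bool → ℕ → Bool
evenLabel e zero    = e
evenLabel e (suc a) = evenLabel (not e) a

-- The edges of Gᵣ, directed upwards, join v to v + 1 for every label v and to
-- v + 2 for v even.
data Step (e : Bool) : ℕ → ℕ → Set where
  next : ∀ {a} → Step e a (suc a)
  skip : ∀ {a} → evenLabel e a ≡ true → Step e a (suc (suc a))

step-suc : ∀ {e a b} → Step (not e) a b → Step e (suc a) (suc b)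
step-suc next     = next
step-suc (skip p) = skip p

step-pred : ∀ {e a b} → Step e (suc a) (suc b) → Step (not e) a b
step-pred next     = next
step-pred (skip p) = skip p

evenLabel-odd : ∀ q → evenLabel false (suc (double q)) ≡ true
evenLabel-odd zero    = ≡.refl
evenLabel-odd (suc q) = evenLabel-odd q

evenLabel-even : ∀ q → evenLabel false (double q) ≡ false
evenLabel-even zero    = ≡.refl
evenLabel-even (suc q) = evenLabel-even q

-- Excluding upward steps suffices, since `i` and `j` range over both orders of a pair.
Independent : ∀ {n} → Bool → Subset n → Set
Independent e C = ∀ i j → i ∈ C → j ∈ C → ¬ Step e (toℕ i) (toℕ j)

module _ (r : ℕ) where
  open HardParticles r

  private
    <⇒<pred : ∀ {q} → suc q < r → q < r ∸ 1
    <⇒<pred lt = ℕₚ.∸-monoˡ-≤ 1 lt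

    twice+1 : ∀ j → 2 ℕ.* (j ℕ.+ 1) ≡ suc (suc (double j))
    twice+1 j = ≡.trans (≡.cong (2 ℕ.*_) (ℕₚ.+-comm j 1)) (2*≡double (suc j))

    twice+2 : ∀ j → 2 ℕ.* (j ℕ.+ 2) ≡ suc (suc (suc (suc (double j))))
    twice+2 j = ≡.trans (≡.cong (2 ℕ.*_) (ℕₚ.+-comm j 2)) (2*≡double (suc (suc j)))

    -- The last three families of `edges`, spelled exactly as there so that the membership lemmas
    -- for `applyUpTo` apply.
    f₂ f₃ f₄ : ℕ → ℕ × ℕ
    f₂ j = 2 ℕ.* (j ℕ.+ 1) , 2 ℕ.* (j ℕ.+ 1) ℕ.+ 1
    f₃ j = 2 ℕ.* (j ℕ.+ 2) ∸ 2 , 2 ℕ.* (j ℕ.+ 2)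
    f₄ j = 2 ℕ.* (j ℕ.+ 2) ∸ 1 , 2 ℕ.* (j ℕ.+ 2)

    f₂≡ : ∀ j → f₂ j ≡ (double (suc j) , suc (double (suc j)))
    f₂≡ j rewrite twice+1 j | ℕₚ.+-comm (double j) 1 = ≡.refl

    f₃≡ : ∀ j → f₃ j ≡ (double (suc j) , double (suc (suc j)))
    f₃≡ j rewrite twice+2 j = ≡.refl

    f₄≡ : ∀ j → f₄ j ≡ (suc (double (suc j)) , double (suc (suc j)))
    f₄≡ j rewrite twice+2 j = ≡.refl

  -- The edge {1,2} and the families `f₂` and `f₄` join consecutive labels; only `f₃` skips a label,
  -- and its lower end is even.
  edge⇒step : ∀ {a b} → (suc a , suc b) List.∈ edges → Step false a b
  edge⇒step (here ≡.refl) = next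
  edge⇒step (there p) with ∈-++⁻ (applyUpTo f₂ r) p
  ... | inj₁ q with ∈-applyUpTo⁻ f₂ q
  ...   | j , _ , eq with ≡.trans eq (f₂≡ j)
  ...     | ≡.refl = next
  edge⇒step (there p) | inj₂ q with ∈-++⁻ (applyUpTo f₃ (r ∸ 1)) q
  ... | inj₁ s with ∈-applyUpTo⁻ f₃ s
  ...   | j , _ , eq with ≡.trans eq (f₃≡ j)
  ...     | ≡.refl = skip (evenLabel-odd j)
  edge⇒step (there p) | inj₂ q | inj₂ s with ∈-applyUpTo⁻ f₄ s
  ...   | j , _ , eq with ≡.trans eq (f₄≡ j)
  ...     | ≡.refl = next

  -- The parity of the position `a` selects the family and the index in it; the bound on `b` keeps
  -- that index in range.
  step⇒edge : ∀ {a b} → b < suc (double r) → Step false a b → (suc a , suc b) List.∈ edges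
  step⇒edge {a} b< next with parity a
  -- Label 1 has the separate edge {1,2}, because `f₄` starts at label 3.
  ... | even zero    = here ≡.refl
  ... | even (suc q) = there (∈-++⁺ʳ (applyUpTo f₂ r) (∈-++⁺ʳ (applyUpTo f₃ (r ∸ 1))
    (≡.subst (List._∈ applyUpTo f₄ (r ∸ 1)) (f₄≡ q) (∈-applyUpTo⁺ f₄ (<⇒<pred (double-cancel-< (s≤s⁻¹ b<)))))))
  ... | odd q        = there (∈-++⁺ˡ
    (≡.subst (List._∈ applyUpTo f₂ r) (f₂≡ q) (∈-applyUpTo⁺ f₂ (double-cancel-≤ (s≤s⁻¹ b<)))))
  step⇒edge {a} b< (skip p) with parity a
  ... | even q with () ← ≡.trans (≡.sym (evenLabel-even q)) p
  ... | odd q  = there (∈-++⁺ʳ (applyUpTo f₂ r) (∈-++⁺ˡ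
    (≡.subst (List._∈ applyUpTo f₃ (r ∸ 1)) (f₃≡ q) (∈-applyUpTo⁺ f₃ (<⇒<pred (double-cancel-< (s≤s⁻¹ b<)))))))

  hard⇔independent : ∀ C → HardConfiguration C ⇔ Independent false C
  hard⇔independent C = mk⇔
    (λ h i j i∈C j∈C s → h i j i∈C j∈C (inj₁ (step⇒edge (bound j) s)))
    (λ { h i j i∈C j∈C (inj₁ p) → h i j i∈C j∈C (edge⇒step p)
       ; h i j i∈C j∈C (inj₂ p) → h j i j∈C i∈C (edge⇒step p) })
    where
    bound : ∀ (j : Vertex) → toℕ j < suc (double r)
    bound j = ≡.subst (λ n → toℕ j < suc n) (2*≡double r) (toℕ<n j)

-- Hard particle configurations recognised by a left-to-right scan

-- The number of later positions blocked by a particle: two on an even label, one on an odd label.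
reach : Bool → ℕ
reach e = if e then 2 else 1

-- q counts the leading positions that are blocked by earlier particles.
admissible : ∀ {n} → Bool → ℕ → Subset n → Bool
admissible e q       Vec.[]              = true
admissible e (suc q) (x Vec.∷ C)         = not x ∧ admissible (not e) q C
admissible e zero    (outside Vec.∷ C)   = admissible (not e) 0 C
admissible e zero    (inside Vec.∷ C)    = admissible (not e) (reach e) C

Vacant : ∀ {n} → ℕ → Subset n → Set
Vacant q C = ∀ j → j ∈ C → q ≤ toℕ j

reach-step : ∀ {e b} → Step e 0 (suc b) → ¬ (reach e ≤ b)
reach-step {false} next          ()
reach-step {true}  next          ()
reach-step {true}  (skip ≡.refl) (s≤s ())

<reach⇒step : ∀ {e b} → b < reach e → Step e 0 (suc b)
<reach⇒step {true}  {zero}        _ = next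
<reach⇒step {true}  {suc zero}    _ = skip ≡.refl
<reach⇒step {true}  {suc (suc b)} (s≤s (s≤s ()))
<reach⇒step {false} {zero}        _ = next
<reach⇒step {false} {suc b}       (s≤s ())

independent-∷ : ∀ {n e x} {C : Subset n} → Independent (not e) C →
  (x ≡ inside → Vacant (reach e) C) → Independent e (x Vec.∷ C)
independent-∷ ind vac zero    zero    _ _ ()
independent-∷ ind vac zero    (suc j) Vec.here j∈ s = reach-step s (vac ≡.refl j (drop-there j∈))
independent-∷ ind vac (suc i) zero    _ _ ()
independent-∷ ind vac (suc i) (suc j) i∈ j∈ s = ind i j (drop-there i∈) (drop-there j∈) (step-pred s)

independent-tail : ∀ {n e x} {C : Subset n} → Independent e (x Vec.∷ C) → Independent (not e) C
independent-tail ind i j i∈ j∈ s = ind (suc i) (suc j) (Vec.there i∈) (Vec.there j∈) (step-suc s)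

-- Vacancy of the blocked positions has to be carried through the induction: for the tail behind a
-- particle it is what rules out a step starting at that particle.
admissible⇒independent : ∀ {n} e q (C : Subset n) →
  T (admissible e q C) → Independent e C × Vacant q C
admissible⇒independent e q       Vec.[]            _  = (λ ()) , (λ ())
admissible⇒independent e (suc q) (outside Vec.∷ C) ok =
  let ind , vac = admissible⇒independent (not e) q C ok in
  independent-∷ ind (λ ()) , (λ { (suc j) j∈ → s≤s (vac j (drop-there j∈)) })
admissible⇒independent e zero    (outside Vec.∷ C) ok =
  let ind , _ = admissible⇒independent (not e) 0 C ok in
  independent-∷ ind (λ ()) , (λ _ _ → z≤n)
admissible⇒independent e zero    (inside Vec.∷ C)  ok =
  let ind , vac = admissible⇒independent (not e) (reach e) C ok in
  independent-∷ ind (λ _ → vac) , (λ _ _ → z≤n)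

independent⇒admissible : ∀ {n} e q (C : Subset n) →
  Independent e C → Vacant q C → T (admissible e q C)
independent⇒admissible e q       Vec.[]            ind vac = tt
independent⇒admissible e (suc q) (inside Vec.∷ C)  ind vac with () ← vac zero Vec.here
independent⇒admissible e (suc q) (outside Vec.∷ C) ind vac =
  independent⇒admissible (not e) q C (independent-tail ind) (λ j j∈ → s≤s⁻¹ (vac (suc j) (Vec.there j∈)))
independent⇒admissible e zero    (outside Vec.∷ C) ind vac =
  independent⇒admissible (not e) 0 C (independent-tail ind) (λ _ _ → z≤n)
independent⇒admissible e zero    (inside Vec.∷ C)  ind vac =
  independent⇒admissible (not e) (reach e) C (independent-tail ind)
    -- A particle within reach would be joined to the one at position 0.
    (λ j j∈ → ℕₚ.≮⇒≥ (λ lt → ind zero (suc j) Vec.here (Vec.there j∈) (<reach⇒step lt)))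

-- Replaces the decision by exhaustive quantification with a structural recursion, along which the
-- sum over subsets can be unfolded.
does-hard : ∀ r C → does (HardParticles.hardConfiguration? r C) ≡ admissible false 0 C
does-hard r C = does-⇔
  (mk⇔ (λ h → independent⇒admissible false 0 C (Equivalence.to (hard⇔independent r C) h) (λ _ _ → z≤n))
       (λ ok → Equivalence.from (hard⇔independent r C) (proj₁ (admissible⇒independent false 0 C ok))))
  (HardParticles.hardConfiguration? r C) (T? (admissible false 0 C))

-- Transfer recursion for the partition function

module Transfer {c₀ ℓ} (A : CommutativeRing c₀ ℓ) where
  open CommutativeRing A hiding (zero)
  open SemiringSolver commutativeSemiring using (solve; _:+_; _:*_; _:=_)
  open SetoidReasoning setoid

  -- The partition function of `n` consecutive positions with the first `q` blocked: the recursion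
  -- of `admissible`, summed over an empty and an occupied first position.
  transfer : Bool → ℕ → ℕ → (ℕ → Carrier) → Carrier
  transfer e q       zero    z = 1#
  transfer e (suc q) (suc n) z = transfer (not e) q n (shift z)
  transfer e zero    (suc n) z =
    transfer (not e) 0 n (shift z) + z 0 * transfer (not e) (reach e) n (shift z)

  particles : ∀ {n} → (ℕ → Carrier) → Subset n → Carrier
  particles z Vec.[]      = 1#
  particles z (x Vec.∷ C) = (if x then z 0 else 1#) * particles (shift z) C

  -- Testing inside the sum keeps the list of all subsets intact, so that it can be split at the
  -- first vertex.
  sumIf : ∀ {a} {X : Set a} → (X → Bool) → (X → Carrier) → List X → Carrier
  sumIf p f []            = 0#
  sumIf p f (x List.∷ xs) = (if p x then f x else 0#) + sumIf p f xs

  sumIf-++ : ∀ {a} {X : Set a} p (f : X → Carrier) xs ys →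
    sumIf p f (xs ++ ys) ≈ sumIf p f xs + sumIf p f ys
  sumIf-++ p f []            ys = sym (+-identityˡ _)
  sumIf-++ p f (x List.∷ xs) ys = trans (+-congˡ (sumIf-++ p f xs ys)) (sym (+-assoc _ _ _))

  sumIf-map : ∀ {a b} {X : Set a} {Y : Set b} p (f : Y → Carrier) (g : X → Y) xs →
    sumIf p f (List.map g xs) ≈ sumIf (p ∘ g) (f ∘ g) xs
  sumIf-map p f g []            = refl
  sumIf-map p f g (x List.∷ xs) = +-congˡ (sumIf-map p f g xs)

  sumIf-scale : ∀ {a} {X : Set a} p (f : X → Carrier) k xs →
    sumIf p (λ x → k * f x) xs ≈ k * sumIf p f xs
  sumIf-scale p f k []            = sym (zeroʳ k)
  sumIf-scale p f k (x List.∷ xs) with p x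
  ... | true  = trans (+-congˡ (sumIf-scale p f k xs)) (sym (distribˡ _ _ _))
  ... | false = trans (+-cong (sym (zeroʳ k)) (sumIf-scale p f k xs)) (sym (distribˡ _ _ _))

  sumIf-none : ∀ {a} {X : Set a} (f : X → Carrier) xs → sumIf (λ _ → false) f xs ≈ 0#
  sumIf-none f []            = refl
  sumIf-none f (x List.∷ xs) = trans (+-identityˡ _) (sumIf-none f xs)

  sum-filter : ∀ {a p} {X : Set a} {P : Pred X p} (P? : Decidable P) p (f g : X → Carrier) →
    (∀ x → does (P? x) ≡ p x) → (∀ x → f x ≈ g x) →
    ∀ xs → List.foldr _+_ 0# (List.map f (List.filter P? xs)) ≈ sumIf p g xs
  sum-filter P? p f g P≡p f≈g []            = refl
  sum-filter P? p f g P≡p f≈g (x List.∷ xs) with does (P? x) | P≡p x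
  ... | true  | eq rewrite ≡.sym eq = +-cong (f≈g x) (sum-filter P? p f g P≡p f≈g xs)
  ... | false | eq rewrite ≡.sym eq =
    trans (sum-filter P? p f g P≡p f≈g xs) (sym (+-identityˡ _))

  module _ (r : ℕ) where
    open HardParticles r
    open PartitionFunction A

    sum-subsets : ∀ n p (f : Subset (suc n) → Carrier) →
      sumIf p f (subsets (suc n)) ≈
        sumIf (p ∘ (outside Vec.∷_)) (f ∘ (outside Vec.∷_)) (subsets n)
          + sumIf (p ∘ (inside Vec.∷_)) (f ∘ (inside Vec.∷_)) (subsets n)
    sum-subsets n p f = begin
      sumIf p f (List.map (outside Vec.∷_) (subsets n) ++ (List.map (inside Vec.∷_) (subsets n) ++ []))
        ≈⟨ sumIf-++ p f (List.map (outside Vec.∷_) (subsets n)) _ ⟩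
      _ + sumIf p f (List.map (inside Vec.∷_) (subsets n) ++ [])
        ≈⟨ +-congˡ (reflexive (≡.cong (sumIf p f) (++-identityʳ (List.map (inside Vec.∷_) (subsets n))))) ⟩
      _ + _
        ≈⟨ +-cong (sumIf-map p f (outside Vec.∷_) (subsets n)) (sumIf-map p f (inside Vec.∷_) (subsets n)) ⟩
      _ ∎

    sum-admissible : ∀ e q n z → sumIf (admissible e q) (particles z) (subsets n) ≈ transfer e q n z
    sum-admissible e q       zero    z = +-identityʳ 1#
    sum-admissible e (suc q) (suc n) z = begin
      _ ≈⟨ sum-subsets n (admissible e (suc q)) (particles z) ⟩
      _ ≈⟨ +-cong (sumIf-scale (admissible (not e) q) (particles (shift z)) 1# (subsets n))
                  (sumIf-none (particles z ∘ (inside Vec.∷_)) (subsets n)) ⟩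
      _ ≈⟨ trans (+-identityʳ _) (*-identityˡ _) ⟩
      _ ≈⟨ sum-admissible (not e) q n (shift z) ⟩
      _ ∎
    sum-admissible e zero    (suc n) z = begin
      _ ≈⟨ sum-subsets n (admissible e 0) (particles z) ⟩
      _ ≈⟨ +-cong (sumIf-scale (admissible (not e) 0) (particles (shift z)) 1# (subsets n))
                  (sumIf-scale (admissible (not e) (reach e)) (particles (shift z)) (z 0) (subsets n)) ⟩
      _ ≈⟨ +-cong (trans (*-identityˡ _) (sum-admissible (not e) 0 n (shift z)))
                  (*-congˡ (sum-admissible (not e) (reach e) n (shift z))) ⟩
      _ ∎

    open CommutativeMonoidSum *-commutativeMonoid using () renaming (sum to product)

    product≈particles : ∀ {n} (w : Vector Carrier n) (z : ℕ → Carrier) → (∀ i → w i ≈ z (toℕ i)) →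
      ∀ C → product (λ i → if Vec.lookup C i then w i else 1#) ≈ particles z C
    product≈particles w z w≈z Vec.[] = refl
    product≈particles w z w≈z (outside Vec.∷ C) =
      *-congˡ (product≈particles (tail w) (shift z) (λ i → w≈z (suc i)) C)
    product≈particles w z w≈z (inside Vec.∷ C) =
      *-cong (w≈z zero) (product≈particles (tail w) (shift z) (λ i → w≈z (suc i)) C)

    Z≈transfer : ∀ w z → (∀ i → w i ≈ z (toℕ i)) → Z w ≈ transfer false 0 (suc (double r)) z
    Z≈transfer w z w≈z = begin
      Z w
        ≈⟨ sum-filter hardConfiguration? (admissible false 0) (weight w) (particles z)
             (does-hard r) (product≈particles w z w≈z) (subsets (suc (2 ℕ.* r))) ⟩
      sumIf (admissible false 0) (particles z) (subsets (suc (2 ℕ.* r)))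
        ≈⟨ sum-admissible false 0 (suc (2 ℕ.* r)) z ⟩
      transfer false 0 (suc (2 ℕ.* r)) z
        ≈⟨ reflexive (≡.cong (λ n → transfer false 0 (suc n) z) (2*≡double r)) ⟩
      transfer false 0 (suc (double r)) z ∎

    -- A zero weight kills the branch with vertex 1 occupied, which leaves the graph on the vertices
    -- from 2 on.
    Z-vacant₁≈transfer : ∀ (w : Vector Carrier (suc (2 ℕ.* r))) (z : ℕ → Carrier) → (∀ i → tail w i ≈ z (suc (toℕ i))) →
      Z (0# ∷ tail w) ≈ transfer true 0 (double r) (shift z)
    Z-vacant₁≈transfer w z w≈z = begin
      Z (0# ∷ tail w)
        ≈⟨ Z≈transfer (0# ∷ tail w) z₀ (λ { zero → refl ; (suc i) → w≈z i }) ⟩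
      transfer true 0 (double r) (shift z) + 0# * transfer true 1 (double r) (shift z)
        ≈⟨ trans (+-congˡ (zeroˡ _)) (+-identityʳ _) ⟩
      transfer true 0 (double r) (shift z) ∎
      where
      -- Erasing the first weight of `z` leaves `shift z₀` equal to `shift z` by computation.
      z₀ : ℕ → Carrier
      z₀ zero    = 0#
      z₀ (suc i) = z (suc i)

  -- For m = r - k and weights o, e of the odd and even labels shifted by k,
  -- fromOdd (suc m) is the partition function of the vertices 2k + 1 , … , 2r + 1
  -- and fromEven m that of 2k + 2 , … , 2r + 1.
  fromOdd fromEven : ℕ → (ℕ → Carrier) → (ℕ → Carrier) → Carrier
  fromOdd zero    o e = 1#
  fromOdd (suc m) o e = fromEven m o e + o 0 * fromOdd m (shift o) (shift e)
  fromEven zero    o e = 1#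
  fromEven (suc m) o e =
    fromOdd (suc m) (shift o) (shift e) + e 0 * fromOdd m (shift (shift o)) (shift (shift e))

  Interleaves : (ℕ → Carrier) → (ℕ → Carrier) → (ℕ → Carrier) → Set ℓ
  Interleaves z o e = ∀ k → z (double k) ≈ o k × z (suc (double k)) ≈ e k

  -- The scan is unrolled in pairs. After a particle on either parity it resumes at an odd label,
  -- two places on from an odd label and three on from an even one; `transfer-blocked` reaches that
  -- label.
  transfer-odd : ∀ m z {o e} → Interleaves z o e →
    transfer false 0 (suc (double m)) z ≈ fromOdd (suc m) o e
  transfer-even : ∀ m z {o e} → Interleaves z o e →
    transfer true 0 (double m) (shift z) ≈ fromEven m o e
  transfer-blocked : ∀ m z {o e} → Interleaves z o e →
    transfer true 1 (double m) (shift z) ≈ fromOdd m (shift o) (shift e)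

  transfer-odd m z z≈ =
    +-cong (transfer-even m z z≈) (*-cong (proj₁ (z≈ 0)) (transfer-blocked m z z≈))

  transfer-even zero    z z≈ = refl
  transfer-even (suc m) z z≈ =
    +-cong (transfer-odd m (shift (shift z)) (λ k → z≈ (suc k)))
           (*-cong (proj₂ (z≈ 0)) (transfer-blocked m (shift (shift z)) (λ k → z≈ (suc k))))

  transfer-blocked zero    z z≈ = refl
  transfer-blocked (suc m) z z≈ = transfer-odd m (shift (shift z)) (λ k → z≈ (suc k))

  -- The quotient-difference step and its conserved quantity

  module Evolution (c : Carrier) where

    -- One time step, with `s k` in the role of S_{k+1}. Inverses are given as data because the ring
    -- will be one of power series. The condition `o′ 0 ≈ s 0` is kept outside, as it would not
    -- survive the shift in `evolves-suc`.
    record Evolves (m : ℕ) (o e o′ e′ s : ℕ → Carrier) : Set (c₀ ⊔ ℓ) where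
      field
        s⁻¹     : ℕ → Carrier
        inverse : ∀ k → k < m → s⁻¹ k * s k ≈ 1#
        split   : ∀ k → k < m → s k ≈ o k + e k
        last    : s m ≈ o m
        even′   : ∀ k → k < m → e′ k * s k ≈ e k * s (suc k)
        odd′    : ∀ k → k < m → o′ (suc k) * s k ≈ o k * s (suc k)

    evolves-suc : ∀ {m o e o′ e′ s} → Evolves (suc m) o e o′ e′ s →
      Evolves m (shift o) (shift e) (shift o′) (shift e′) (shift s)
    evolves-suc ev = record
      { s⁻¹     = shift s⁻¹
      ; inverse = λ k k<m → inverse (suc k) (s≤s k<m)
      ; split   = λ k k<m → split (suc k) (s≤s k<m)
      ; last    = last
      ; even′   = λ k k<m → even′ (suc k) (s≤s k<m)
      ; odd′    = λ k k<m → odd′ (suc k) (s≤s k<m)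
      }
      where open Evolves ev

    scaledOdd scaledEven : ℕ → (ℕ → Carrier) → (ℕ → Carrier) → Carrier
    scaledOdd m o e = fromOdd m (λ k → c * o k) (λ k → c * e k)
    scaledEven m o e = fromEven m (λ k → c * o k) (λ k → c * e k)

    -- The coefficient of c in scaledOdd (suc m) o e relative to scaledOdd m of the
    -- shifted weights: for k = r - m this is y_{2k+1} B_{k+1} + y_{2k+2} B_{k+2}.
    slope : ℕ → (ℕ → Carrier) → (ℕ → Carrier) → Carrier
    slope zero    o e = o 0
    slope (suc m) o e = o 0 * scaledOdd (suc m) (shift o) (shift e) + e 0 * scaledOdd m (shift (shift o)) (shift (shift e))

    -- The first two vertices are adjacent, so at most one of them is occupied; the occupied cases
    -- make up the `slope` term.
    fromOdd-slope : ∀ m o e → scaledOdd (suc m) o e ≈ scaledOdd m (shift o) (shift e) + c * slope m o e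
    fromOdd-slope zero    o e = +-congˡ (*-identityʳ _)
    fromOdd-slope (suc m) o e =
      solve 5 (λ c o e B B⁺ → B :+ c :* e :* B⁺ :+ c :* o :* B := B :+ c :* (o :* B :+ e :* B⁺))
        refl c (o 0) (e 0) (scaledOdd (suc m) (shift o) (shift e)) (scaledOdd m (shift (shift o)) (shift (shift e)))

    cancel : ∀ {m o e o′ e′ s} → Evolves (suc m) o e o′ e′ s → ∀ {x y} → s 0 * x ≈ s 0 * y → x ≈ y
    cancel {s = s} ev {x} {y} eq = begin
      x                      ≈⟨ unit x ⟨
      s⁻¹ 0 * (s 0 * x)      ≈⟨ *-congˡ eq ⟩
      s⁻¹ 0 * (s 0 * y)      ≈⟨ unit y ⟩
      y                      ∎
      where
      open Evolves ev
      unit : ∀ x → s⁻¹ 0 * (s 0 * x) ≈ x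
      unit x = trans (sym (*-assoc _ _ _)) (trans (*-congʳ (inverse 0 (s≤s z≤n))) (*-identityˡ x))

    -- Mutual induction with `fromEven-evolves`. The factor `s 0` turns a primed weight into an
    -- unprimed one times `s 1`, and the induction hypothesis absorbs that `s 1`.
    fromOdd-evolves : ∀ m {o e o′ e′ s} → Evolves m o e o′ e′ s →
      s 0 * scaledOdd m (shift o′) (shift e′) ≈ slope m o e
    fromEven-evolves : ∀ m {o e o′ e′ s} → Evolves m o e o′ e′ s →
      scaledEven m o′ e′ ≈ scaledOdd m (shift o) (shift e)

    fromOdd-evolves zero    ev = trans (*-identityʳ _) (Evolves.last ev)
    fromOdd-evolves (suc m) {o} {e} {o′} {e′} {s} ev = begin
      s 0 * (A′ + c * o′ 1 * B′)
        ≈⟨ solve 5 (λ s A c o B → s :* (A :+ c :* o :* B) := s :* A :+ c :* (o :* s) :* B)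
             refl (s 0) A′ c (o′ 1) B′ ⟩
      s 0 * A′ + c * (o′ 1 * s 0) * B′
        ≈⟨ +-cong (*-cong (split 0 (s≤s z≤n)) (fromEven-evolves m ev⁺))
                  (*-congʳ (*-congˡ (odd′ 0 (s≤s z≤n)))) ⟩
      (o 0 + e 0) * B⁺ + c * (o 0 * s 1) * B′
        ≈⟨ solve 6 (λ o e B c s B′ → (o :+ e) :* B :+ c :* (o :* s) :* B′
             := o :* (B :+ c :* (s :* B′)) :+ e :* B) refl (o 0) (e 0) B⁺ c (s 1) B′ ⟩
      o 0 * (B⁺ + c * (s 1 * B′)) + e 0 * B⁺
        ≈⟨ +-congʳ (*-congˡ (+-congˡ (*-congˡ (fromOdd-evolves m ev⁺)))) ⟩
      o 0 * (B⁺ + c * slope m (shift o) (shift e)) + e 0 * B⁺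
        ≈⟨ +-congʳ (*-congˡ (fromOdd-slope m (shift o) (shift e))) ⟨
      slope (suc m) o e ∎
      where
      open Evolves ev
      ev⁺ = evolves-suc ev
      A′ = scaledEven m (shift o′) (shift e′)
      B′ = scaledOdd m (shift (shift o′)) (shift (shift e′))
      B⁺ = scaledOdd m (shift (shift o)) (shift (shift e))

    fromEven-evolves zero    ev = refl
    fromEven-evolves (suc m) {o} {e} {o′} {e′} {s} ev = cancel ev (begin
      s 0 * (B₁′ + c * e′ 0 * B₂′)
        ≈⟨ solve 5 (λ s B c e B′ → s :* (B :+ c :* e :* B′) := s :* B :+ c :* (e :* s) :* B′)
             refl (s 0) B₁′ c (e′ 0) B₂′ ⟩
      s 0 * B₁′ + c * (e′ 0 * s 0) * B₂′
        ≈⟨ +-cong (fromOdd-evolves (suc m) ev) (*-congʳ (*-congˡ (even′ 0 (s≤s z≤n)))) ⟩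
      (o 0 * B₁ + e 0 * B₂) + c * (e 0 * s 1) * B₂′
        ≈⟨ solve 7 (λ o B₁ e B₂ c s B₂′ → (o :* B₁ :+ e :* B₂) :+ c :* (e :* s) :* B₂′
             := o :* B₁ :+ e :* (B₂ :+ c :* (s :* B₂′))) refl (o 0) B₁ (e 0) B₂ c (s 1) B₂′ ⟩
      o 0 * B₁ + e 0 * (B₂ + c * (s 1 * B₂′))
        ≈⟨ +-congˡ (*-congˡ (+-congˡ (*-congˡ (fromOdd-evolves m (evolves-suc ev))))) ⟩
      o 0 * B₁ + e 0 * (B₂ + c * slope m (shift o) (shift e))
        -- The bracket is the expansion of `B₁`, so both weights now multiply `B₁` and add up to
        -- `s 0`.
        ≈⟨ +-congˡ (*-congˡ (fromOdd-slope m (shift o) (shift e))) ⟨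
      o 0 * B₁ + e 0 * B₁
        ≈⟨ distribʳ B₁ (o 0) (e 0) ⟨
      (o 0 + e 0) * B₁
        ≈⟨ *-congʳ (split 0 (s≤s z≤n)) ⟨
      s 0 * B₁ ∎)
      where
      open Evolves ev
      B₁′ = scaledOdd (suc m) (shift o′) (shift e′)
      B₂′ = scaledOdd m (shift (shift o′)) (shift (shift e′))
      B₁  = scaledOdd (suc m) (shift o) (shift e)
      B₂  = scaledOdd m (shift (shift o)) (shift (shift e))

    -- The boundary condition supplies the factor `s 0` that `fromOdd-evolves` requires; the result
    -- is the `fromOdd-slope` expansion at the earlier time.
    fromOdd-conserved : ∀ m {o e o′ e′ s} → Evolves m o e o′ e′ s → o′ 0 ≈ s 0 →
      scaledOdd (suc m) o′ e′ ≈ scaledOdd (suc m) o e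
    fromOdd-conserved m {o} {e} {o′} {e′} {s} ev o′≈s = begin
      scaledEven m o′ e′ + c * o′ 0 * B′
        ≈⟨ +-cong (fromEven-evolves m ev) (trans (*-congʳ (*-congˡ o′≈s)) (*-assoc c (s 0) B′)) ⟩
      scaledOdd m (shift o) (shift e) + c * (s 0 * B′)
        ≈⟨ +-congˡ (*-congˡ (fromOdd-evolves m ev)) ⟩
      scaledOdd m (shift o) (shift e) + c * slope m o e
        ≈⟨ fromOdd-slope m o e ⟨
      scaledOdd (suc m) o e ∎
      where B′ = scaledOdd m (shift o′) (shift e′)

-- Calculus of fractions

module FieldProperties {c ℓ} (K : DecField c ℓ) where
  open DecField K
  open SemiringSolver commutativeSemiring using (solve; _:+_; _:*_; _:=_)
  open SetoidReasoning setoid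

  *-cancelʳ-nonzero : ∀ {x y d} → ¬ (d ≈ 0#) → x * d ≈ y * d → x ≈ y
  *-cancelʳ-nonzero {x} {y} {d} d≉0 eq =
    trans (sym (unit x)) (trans (*-congʳ eq) (unit y))
    where
    unit : ∀ x → x * d * d ⁻¹ ≈ x
    unit x = trans (*-assoc x d (d ⁻¹)) (trans (*-congˡ (⁻¹-inverse d≉0)) (*-identityʳ x))

  *-nonzero : ∀ {x y} → ¬ (x ≈ 0#) → ¬ (y ≈ 0#) → ¬ (x * y ≈ 0#)
  *-nonzero x≉0 y≉0 eq = x≉0 (*-cancelʳ-nonzero y≉0 (trans eq (sym (zeroˡ _))))

  /-*-cancel : ∀ x {d} → ¬ (d ≈ 0#) → x / d * d ≈ x
  /-*-cancel x {d} d≉0 =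
    trans (*-assoc x (d ⁻¹) d)
      (trans (*-congˡ (trans (*-comm (d ⁻¹) d) (⁻¹-inverse d≉0))) (*-identityʳ x))

  /-nonzero : ∀ {x d} → ¬ (x ≈ 0#) → ¬ (d ≈ 0#) → ¬ (x / d ≈ 0#)
  /-nonzero {x} x≉0 d≉0 eq =
    x≉0 (trans (sym (/-*-cancel x d≉0)) (trans (*-congʳ eq) (zeroˡ _)))

  /-cross : ∀ {x₁ d₁ x₂ d₂} → ¬ (d₁ ≈ 0#) → ¬ (d₂ ≈ 0#) → x₁ * d₂ ≈ x₂ * d₁ → x₁ / d₁ ≈ x₂ / d₂
  /-cross {x₁} {d₁} {x₂} {d₂} d₁≉0 d₂≉0 eq = *-cancelʳ-nonzero (*-nonzero d₁≉0 d₂≉0) (begin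
    x₁ / d₁ * (d₁ * d₂)   ≈⟨ *-assoc _ d₁ d₂ ⟨
    x₁ / d₁ * d₁ * d₂     ≈⟨ *-congʳ (/-*-cancel x₁ d₁≉0) ⟩
    x₁ * d₂               ≈⟨ eq ⟩
    x₂ * d₁               ≈⟨ *-congʳ (/-*-cancel x₂ d₂≉0) ⟨
    x₂ / d₂ * d₂ * d₁     ≈⟨ solve 3 (λ q d₂ d₁ → q :* d₂ :* d₁ := q :* (d₁ :* d₂)) refl (x₂ / d₂) d₂ d₁ ⟩
    x₂ / d₂ * (d₁ * d₂)   ∎)

  /-* : ∀ {x₁ d₁ x₂ d₂} → ¬ (d₁ ≈ 0#) → ¬ (d₂ ≈ 0#) → x₁ / d₁ * (x₂ / d₂) ≈ (x₁ * x₂) / (d₁ * d₂)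
  /-* {x₁} {d₁} {x₂} {d₂} d₁≉0 d₂≉0 = *-cancelʳ-nonzero (*-nonzero d₁≉0 d₂≉0) (begin
    x₁ / d₁ * (x₂ / d₂) * (d₁ * d₂)
      ≈⟨ solve 4 (λ q₁ q₂ d₁ d₂ → q₁ :* q₂ :* (d₁ :* d₂) := (q₁ :* d₁) :* (q₂ :* d₂)) refl (x₁ / d₁) (x₂ / d₂) d₁ d₂ ⟩
    x₁ / d₁ * d₁ * (x₂ / d₂ * d₂)
      ≈⟨ *-cong (/-*-cancel x₁ d₁≉0) (/-*-cancel x₂ d₂≉0) ⟩
    x₁ * x₂
      ≈⟨ /-*-cancel (x₁ * x₂) (*-nonzero d₁≉0 d₂≉0) ⟨
    (x₁ * x₂) / (d₁ * d₂) * (d₁ * d₂) ∎)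

  /-+ : ∀ {x₁ d₁ x₂ d₂} → ¬ (d₁ ≈ 0#) → ¬ (d₂ ≈ 0#) →
    x₁ / d₁ + x₂ / d₂ ≈ (x₁ * d₂ + x₂ * d₁) / (d₁ * d₂)
  /-+ {x₁} {d₁} {x₂} {d₂} d₁≉0 d₂≉0 = *-cancelʳ-nonzero (*-nonzero d₁≉0 d₂≉0) (begin
    (x₁ / d₁ + x₂ / d₂) * (d₁ * d₂)
      ≈⟨ solve 4 (λ q₁ q₂ d₁ d₂ → (q₁ :+ q₂) :* (d₁ :* d₂) := (q₁ :* d₁) :* d₂ :+ (q₂ :* d₂) :* d₁) refl (x₁ / d₁) (x₂ / d₂) d₁ d₂ ⟩
    x₁ / d₁ * d₁ * d₂ + x₂ / d₂ * d₂ * d₁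
      ≈⟨ +-cong (*-congʳ (/-*-cancel x₁ d₁≉0)) (*-congʳ (/-*-cancel x₂ d₂≉0)) ⟩
    x₁ * d₂ + x₂ * d₁
      ≈⟨ /-*-cancel _ (*-nonzero d₁≉0 d₂≉0) ⟨
    (x₁ * d₂ + x₂ * d₁) / (d₁ * d₂) * (d₁ * d₂) ∎)

  /-*-cross : ∀ {x₁ d₁ x₂ d₂ x₃ d₃ x₄ d₄} →
    ¬ (d₁ ≈ 0#) → ¬ (d₂ ≈ 0#) → ¬ (d₃ ≈ 0#) → ¬ (d₄ ≈ 0#) →
    (x₁ * x₂) * (d₃ * d₄) ≈ (x₃ * x₄) * (d₁ * d₂) →
    x₁ / d₁ * (x₂ / d₂) ≈ x₃ / d₃ * (x₄ / d₄)
  /-*-cross d₁≉0 d₂≉0 d₃≉0 d₄≉0 eq =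
    trans (/-* d₁≉0 d₂≉0)
      (trans (/-cross (*-nonzero d₁≉0 d₂≉0) (*-nonzero d₃≉0 d₄≉0) eq) (sym (/-* d₃≉0 d₄≉0)))

-- The Q-system as a quotient-difference scheme

-- The Q-system at nonnegative times over any field, with both indices of the recurrence moved so
-- that no subtraction occurs.
record IsQSystemℕ {c ℓ} (K : DecField c ℓ) (r : ℕ) (F : ℕ → ℕ → DecField.Carrier K) : Set ℓ where
  open DecField K
  field
    nonzero    : ∀ α n → α ≤ suc r → ¬ (F α n ≈ 0#)
    boundary₀  : ∀ n → F 0 n ≈ 1#
    boundary₁  : ∀ n → F (suc r) n ≈ 1#
    recurrence : ∀ α n → α < r → F (suc α) (suc (suc n)) * F (suc α) n
      ≈ F (suc α) (suc n) * F (suc α) (suc n) + F (suc (suc α)) (suc n) * F α (suc n)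

module QSystemWeights {c ℓ} (K : DecField c ℓ) (r : ℕ) (F : ℕ → ℕ → DecField.Carrier K)
                      (isQSystem : IsQSystemℕ K r F) where
  open DecField K hiding (zero)
  open FieldProperties K
  open IsQSystemℕ isQSystem
  open SemiringSolver commutativeSemiring using (solve; _:+_; _:*_; _:=_; con)
  open SetoidReasoning setoid

  -- y-odd n k and y-even n k are y_{2k+1} and y_{2k+2} with the initial times 0, 1
  -- replaced by n, n + 1.
  y-odd y-even y-sum : ℕ → ℕ → Carrier
  y-odd  n k = (F k n * F (suc k) (suc n)) / (F (suc k) n * F k (suc n))
  y-even n k = (F k n * F (suc (suc k)) (suc n)) / (F (suc k) n * F (suc k) (suc n))
  y-sum  n k = (F k n * F (suc k) (suc (suc n))) / (F k (suc n) * F (suc k) (suc n))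

  private
    nonzero₀ : ∀ {k} n → k ≤ r → ¬ (F k n ≈ 0#)
    nonzero₀ n k≤r = nonzero _ n (ℕₚ.m≤n⇒m≤1+n k≤r)

    nonzero₁ : ∀ {k} n → k ≤ r → ¬ (F (suc k) n ≈ 0#)
    nonzero₁ n k≤r = nonzero _ n (s≤s k≤r)

    den-odd : ∀ n {k} → k ≤ r → ¬ (F (suc k) n * F k (suc n) ≈ 0#)
    den-odd n k≤r = *-nonzero (nonzero₁ n k≤r) (nonzero₀ (suc n) k≤r)

    den-even : ∀ n {k} → k ≤ r → ¬ (F (suc k) n * F (suc k) (suc n) ≈ 0#)
    den-even n k≤r = *-nonzero (nonzero₁ n k≤r) (nonzero₁ (suc n) k≤r)

    den-sum : ∀ n {k} → k ≤ r → ¬ (F k (suc n) * F (suc k) (suc n) ≈ 0#)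
    den-sum n k≤r = *-nonzero (nonzero₀ (suc n) k≤r) (nonzero₁ (suc n) k≤r)

  y-sum-nonzero : ∀ n k → k ≤ r → ¬ (y-sum n k ≈ 0#)
  y-sum-nonzero n k k≤r =
    /-nonzero (*-nonzero (nonzero₀ n k≤r) (nonzero₁ (suc (suc n)) k≤r)) (den-sum n k≤r)

  -- Over a common denominator the sum has the right side of the recurrence as a factor; the left
  -- side collapses it to a single quotient, visibly nonzero.
  y-sum-split : ∀ n k → k < r → y-sum n k ≈ y-odd n k + y-even n k
  y-sum-split n k k<r = trans
    (/-cross (den-sum n k≤r) (*-nonzero (den-odd n k≤r) (den-even n k≤r)) (begin
      F k n * F (suc k) (suc (suc n)) * (b * a₁ * (b * b₁))
        ≈⟨ solve 5 (λ a b₂ b a₁ b₁ → a :* b₂ :* (b :* a₁ :* (b :* b₁)) := (b₂ :* b) :* (a :* a₁ :* b :* b₁))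
             refl a (F (suc k) (suc (suc n))) b a₁ b₁ ⟩
      F (suc k) (suc (suc n)) * b * (a * a₁ * b * b₁)
        ≈⟨ *-congʳ (recurrence k n k<r) ⟩
      (b₁ * b₁ + c₁ * a₁) * (a * a₁ * b * b₁)
        ≈⟨ solve 5 (λ a b a₁ b₁ c₁ → (b₁ :* b₁ :+ c₁ :* a₁) :* (a :* a₁ :* b :* b₁)
             := (a :* b₁ :* (b :* b₁) :+ a :* c₁ :* (b :* a₁)) :* (a₁ :* b₁)) refl a b a₁ b₁ c₁ ⟩
      (a * b₁ * (b * b₁) + a * c₁ * (b * a₁)) * (a₁ * b₁) ∎))
    (sym (/-+ (den-odd n k≤r) (den-even n k≤r)))
    where
    k≤r = ℕₚ.<⇒≤ k<r
    a  = F k n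
    b  = F (suc k) n
    a₁ = F k (suc n)
    b₁ = F (suc k) (suc n)
    c₁ = F (suc (suc k)) (suc n)

  -- The boundary row `F (suc r)` is 1 at all times, so its time index can be changed freely;
  -- `y-odd-first` uses row 0 in the same way.
  y-sum-last : ∀ n → y-sum n r ≈ y-odd n r
  y-sum-last n = /-cross (den-sum n ℕₚ.≤-refl) (den-odd n ℕₚ.≤-refl) (begin
    F r n * F (suc r) (suc (suc n)) * (F (suc r) n * F r (suc n))
      ≈⟨ *-cong (*-congˡ (boundary₁ _)) (*-congʳ (boundary₁ _)) ⟩
    F r n * 1# * (1# * F r (suc n))
      ≈⟨ solve 2 (λ a a₁ → a :* con 1 :* (con 1 :* a₁) := a :* con 1 :* (a₁ :* con 1)) refl (F r n) (F r (suc n)) ⟩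
    F r n * 1# * (F r (suc n) * 1#)
      ≈⟨ *-cong (*-congˡ (boundary₁ _)) (*-congˡ (boundary₁ _)) ⟨
    F r n * F (suc r) (suc n) * (F r (suc n) * F (suc r) (suc n)) ∎)

  y-odd-first : ∀ n → y-odd (suc n) 0 ≈ y-sum n 0
  y-odd-first n = /-cross (den-odd (suc n) z≤n) (den-sum n z≤n) (begin
    F 0 (suc n) * F 1 (suc (suc n)) * (F 0 (suc n) * F 1 (suc n))
      ≈⟨ *-cong (*-congʳ (boundary₀ _)) (*-congʳ (boundary₀ _)) ⟩
    1# * F 1 (suc (suc n)) * (1# * F 1 (suc n))
      ≈⟨ solve 2 (λ b₂ b₁ → con 1 :* b₂ :* (con 1 :* b₁) := con 1 :* b₂ :* (b₁ :* con 1)) refl (F 1 (suc (suc n))) (F 1 (suc n)) ⟩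
    1# * F 1 (suc (suc n)) * (F 1 (suc n) * 1#)
      ≈⟨ *-cong (*-congʳ (boundary₀ _)) (*-congˡ (boundary₀ _)) ⟨
    F 0 n * F 1 (suc (suc n)) * (F 1 (suc n) * F 0 (suc (suc n))) ∎)

  -- Both sides are Laurent monomials in `F`, so this and `y-odd-evolves` are pure cancellation; the
  -- recurrence enters only through `y-sum-split`.
  y-even-evolves : ∀ n k → k < r → y-even (suc n) k * y-sum n k ≈ y-even n k * y-sum n (suc k)
  y-even-evolves n k k<r =
    /-*-cross (den-even (suc n) k≤r) (den-sum n k≤r) (den-even n k≤r) (den-sum n k<r)
      (solve 7 (λ a b a₁ b₁ c₁ b₂ c₂ →
          (a₁ :* c₂) :* (a :* b₂) :* ((b :* b₁) :* (b₁ :* c₁))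
          := (a :* c₁) :* (b :* c₂) :* ((b₁ :* b₂) :* (a₁ :* b₁)))
        refl (F k n) (F (suc k) n) (F k (suc n)) (F (suc k) (suc n)) (F (suc (suc k)) (suc n))
        (F (suc k) (suc (suc n))) (F (suc (suc k)) (suc (suc n))))
    where k≤r = ℕₚ.<⇒≤ k<r

  y-odd-evolves : ∀ n k → k < r → y-odd (suc n) (suc k) * y-sum n k ≈ y-odd n k * y-sum n (suc k)
  y-odd-evolves n k k<r =
    /-*-cross (den-odd (suc n) k<r) (den-sum n k≤r) (den-odd n k≤r) (den-sum n k<r)
      (solve 7 (λ a b a₁ b₁ c₁ b₂ c₂ →
          (b₁ :* c₂) :* (a :* b₂) :* ((b :* a₁) :* (b₁ :* c₁))
          := (a :* b₁) :* (b :* c₂) :* ((c₁ :* b₂) :* (a₁ :* b₁)))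
        refl (F k n) (F (suc k) n) (F k (suc n)) (F (suc k) (suc n)) (F (suc (suc k)) (suc n))
        (F (suc k) (suc (suc n))) (F (suc (suc k)) (suc (suc n))))
    where k≤r = ℕₚ.<⇒≤ k<r

  F₁-step : ∀ n → F 1 n * y-odd n 0 ≈ F 1 (suc n)
  F₁-step n = *-cancelʳ-nonzero (den-odd n z≤n) (begin
    F 1 n * y-odd n 0 * (F 1 n * F 0 (suc n))
      ≈⟨ *-assoc (F 1 n) (y-odd n 0) _ ⟩
    F 1 n * (y-odd n 0 * (F 1 n * F 0 (suc n)))
      ≈⟨ *-congˡ (/-*-cancel _ (den-odd n z≤n)) ⟩
    F 1 n * (F 0 n * F 1 (suc n))
      ≈⟨ *-congˡ (*-congʳ (trans (boundary₀ n) (sym (boundary₀ (suc n))))) ⟩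
    F 1 n * (F 0 (suc n) * F 1 (suc n))
      ≈⟨ solve 3 (λ b a₁ b₁ → b :* (a₁ :* b₁) := b₁ :* (b :* a₁)) refl (F 1 n) (F 0 (suc n)) (F 1 (suc n)) ⟩
    F 1 (suc n) * (F 1 n * F 0 (suc n)) ∎)

-- Constants, shifts and constant terms of power series

module SeriesProperties {c ℓ} (A : CommutativeRing c ℓ) where
  open CommutativeRing A hiding (zero)
  open PowerSeries A
  open Transfer series-commutativeRing using (fromOdd; fromEven)

  const-cong : ∀ {a b} → a ≈ b → const a ≈ₛ const b
  const-cong a≈b zero    = a≈b
  const-cong a≈b (suc n) = refl

  const-+ : ∀ a b → const (a + b) ≈ₛ const a +ₛ const b
  const-+ a b zero    = refl
  const-+ a b (suc n) = sym (+-identityˡ 0#)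

  const-* : ∀ a b → const (a * b) ≈ₛ const a *ₛ const b
  const-* a b zero    = sym (+-identityʳ (a * b))
  const-* a b (suc n) = sym (trans (+-cong (zeroʳ a) (*ₛ-zeroˡ (const b) n)) (+-identityˡ 0#))

  t*-zero : ∀ f → (t *ₛ f) 0 ≈ 0#
  t*-zero f = trans (+-identityʳ _) (zeroˡ _)

  t*-suc : ∀ f n → (t *ₛ f) (suc n) ≈ f n
  t*-suc f n = trans (+-cong (zeroˡ _) (*ₛ-identityˡ f n)) (+-identityˡ _)

  *ₛ-constantTerm-zero : ∀ {f} → f 0 ≈ 0# → ∀ g → (f *ₛ g) 0 ≈ 0#
  *ₛ-constantTerm-zero f₀≈0 g = trans (+-identityʳ _) (trans (*-congʳ f₀≈0) (zeroˡ _))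

  -- Only the empty configuration contributes, as every particle brings a factor without constant
  -- term.
  fromOdd-constantTerm : ∀ m {o e} → (∀ k → o k 0 ≈ 0#) → (∀ k → e k 0 ≈ 0#) → fromOdd m o e 0 ≈ 1#
  fromEven-constantTerm : ∀ m {o e} → (∀ k → o k 0 ≈ 0#) → (∀ k → e k 0 ≈ 0#) → fromEven m o e 0 ≈ 1#

  fromOdd-constantTerm zero    o₀ e₀ = refl
  fromOdd-constantTerm (suc m) {o} {e} o₀ e₀ =
    trans (+-cong (fromEven-constantTerm m o₀ e₀)
                  (*ₛ-constantTerm-zero {o 0} (o₀ 0) (fromOdd m (shift o) (shift e))))
          (+-identityʳ 1#)

  fromEven-constantTerm zero    o₀ e₀ = refl
  fromEven-constantTerm (suc m) {o} {e} o₀ e₀ =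
    trans (+-cong (fromOdd-constantTerm (suc m) (λ k → o₀ (suc k)) (λ k → e₀ (suc k)))
                  (*ₛ-constantTerm-zero {e 0} (e₀ 0) (fromOdd m (shift (shift o)) (shift (shift e)))))
          (+-identityʳ 1#)

-- The generating function as a quotient of partition functions

module QSystemSeries {c ℓ} (K : DecField c ℓ) (r : ℕ) (F : ℕ → ℕ → DecField.Carrier K)
                     (isQSystem : IsQSystemℕ K r F) where
  open DecField K hiding (zero)
  open PowerSeriesDivision K
  open SeriesProperties commutativeRing
  open QSystemWeights K r F isQSystem
  open Transfer series-commutativeRing
  open Evolution (-ₛ t)
  open HardParticles r using (module PartitionFunction)
  open PartitionFunction series-commutativeRing using (Z)
  private
    module S = CommutativeRing series-commutativeRing
  open SemiringSolver S.commutativeSemiring using (solve; _:+_; _:*_; _:=_)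
  open RingProperties S.ring using (-‿distribˡ-*)

  odds evens sums : ℕ → ℕ → Series
  odds  n k = const (y-odd n k)
  evens n k = const (y-even n k)
  sums  n k = const (y-sum n k)

  evolves : ∀ n → Evolves r (odds n) (evens n) (odds (suc n)) (evens (suc n)) (sums n)
  evolves n = record
    -- The weights are constant series and `c` alone carries `t`, so the inverses can be taken in
    -- the field.
    { s⁻¹     = λ k → const (y-sum n k ⁻¹)
    ; inverse = λ k k<r → S.trans (S.sym (const-* _ _)) (const-cong
        (trans (*-comm _ _) (⁻¹-inverse (y-sum-nonzero n k (ℕₚ.<⇒≤ k<r)))))
    ; split   = λ k k<r → S.trans (const-cong (y-sum-split n k k<r)) (const-+ _ _)
    ; last    = const-cong (y-sum-last n)
    ; even′   = λ k k<r → const-*-cong (y-even-evolves n k k<r)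
    ; odd′    = λ k k<r → const-*-cong (y-odd-evolves n k k<r)
    }
    where
    const-*-cong : ∀ {a b a′ b′} → a * b ≈ a′ * b′ → const a *ₛ const b ≈ₛ const a′ *ₛ const b′
    const-*-cong eq = S.trans (S.sym (const-* _ _)) (S.trans (const-cong eq) (const-* _ _))

  denominator numerator : ℕ → Series
  denominator n = scaledOdd (suc r) (odds n) (evens n)
  numerator   n = scaledEven r (odds n) (evens n)

  denominator-conserved : ∀ n → denominator n ≈ₛ denominator 0
  denominator-conserved zero    = S.refl
  denominator-conserved (suc n) =
    S.trans (fromOdd-conserved r (evolves n) (const-cong (y-odd-first n))) (denominator-conserved n)

  -- In the term of `denominator n` with vertex 1 occupied, `F₁-step` absorbs the weight y_1 and
  -- `fromEven-evolves` identifies the cofactor as the next numerator.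
  R₁-denominator : ∀ n → const (F 1 n) *ₛ denominator n
    ≈ₛ const (F 1 n) *ₛ numerator n +ₛ (-ₛ t) *ₛ (const (F 1 (suc n)) *ₛ numerator (suc n))
  R₁-denominator n = begin
    x *ₛ (numerator n +ₛ (-ₛ t) *ₛ odds n 0 *ₛ b)
      ≈⟨ solve 5 (λ x a c o b → x :* (a :+ c :* o :* b) := x :* a :+ c :* ((x :* o) :* b))
           S.refl x (numerator n) (-ₛ t) (odds n 0) b ⟩
    x *ₛ numerator n +ₛ (-ₛ t) *ₛ (x *ₛ odds n 0 *ₛ b)
      ≈⟨ S.+-congˡ {x *ₛ numerator n} (S.*-congˡ { -ₛ t} (S.*-cong
           (S.trans (S.sym (const-* _ _)) (const-cong (F₁-step n)))
           (S.sym (fromEven-evolves r (evolves n))))) ⟩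
    x *ₛ numerator n +ₛ (-ₛ t) *ₛ (const (F 1 (suc n)) *ₛ numerator (suc n)) ∎
    where
    open SetoidReasoning S.setoid
    x = const (F 1 n)
    b = scaledOdd r (shift (odds n)) (shift (evens n))

  -- Any inverse is allowed, so that `Z w ⁻¹ₛ` can be used without comparing reciprocals.
  module _ (d⁻¹ : Series) (inverse : denominator 0 *ₛ d⁻¹ ≈ₛ 1ₛ) where

    quotient : ℕ → Series
    quotient n = const (F 1 n) *ₛ (numerator n *ₛ d⁻¹)

    quotient-step : ∀ n → quotient n ≈ₛ const (F 1 n) +ₛ t *ₛ quotient (suc n)
    quotient-step n = begin
      q
        ≈⟨ S.+-identityʳ q ⟨
      q +ₛ 0ₛ
        -- Zero is inserted as `-ₛ t` plus `t`, times `q′`: the first part completes the right side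
        -- of `R₁-denominator`, the second remains.
        ≈⟨ S.+-congˡ {q} (S.trans (S.*-congʳ {q′} (S.-‿inverseˡ t)) (S.zeroˡ q′)) ⟨
      q +ₛ ((-ₛ t) +ₛ t) *ₛ q′
        ≈⟨ solve 7 (λ x a i c t x′ a′ → x :* (a :* i) :+ (c :+ t) :* (x′ :* (a′ :* i))
             := (x :* a :+ c :* (x′ :* a′)) :* i :+ t :* (x′ :* (a′ :* i)))
             S.refl x (numerator n) d⁻¹ (-ₛ t) t (const (F 1 (suc n))) (numerator (suc n)) ⟩
      (x *ₛ numerator n +ₛ (-ₛ t) *ₛ (const (F 1 (suc n)) *ₛ numerator (suc n))) *ₛ d⁻¹ +ₛ t *ₛ q′
        ≈⟨ S.+-congʳ {t *ₛ q′} (S.*-congʳ {d⁻¹} (R₁-denominator n)) ⟨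
      x *ₛ denominator n *ₛ d⁻¹ +ₛ t *ₛ q′
        ≈⟨ S.+-congʳ {t *ₛ q′} (S.*-assoc x (denominator n) d⁻¹) ⟩
      x *ₛ (denominator n *ₛ d⁻¹) +ₛ t *ₛ q′
        ≈⟨ S.+-congʳ {t *ₛ q′} (S.*-congˡ {x} (S.trans (S.*-congʳ {d⁻¹} (denominator-conserved n)) inverse)) ⟩
      x *ₛ 1ₛ +ₛ t *ₛ q′
        ≈⟨ S.+-congʳ {t *ₛ q′} (S.*-identityʳ x) ⟩
      x +ₛ t *ₛ q′ ∎
      where
      open SetoidReasoning S.setoid
      x  = const (F 1 n)
      q  = quotient n
      q′ = quotient (suc n)

    -- Each use of `quotient-step` trades one degree in `t` for one unit of time, so the induction
    -- runs over all `n` at once.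
    quotient-coefficient : ∀ k n → quotient n k ≈ F 1 (k ℕ.+ n)
    quotient-coefficient zero    n =
      trans (quotient-step n 0) (trans (+-congˡ (t*-zero (quotient (suc n)))) (+-identityʳ _))
    quotient-coefficient (suc k) n = begin
      quotient n (suc k)
        ≈⟨ quotient-step n (suc k) ⟩
      0# + (t *ₛ quotient (suc n)) (suc k)
        ≈⟨ trans (+-identityˡ _) (t*-suc (quotient (suc n)) k) ⟩
      quotient (suc n) k
        ≈⟨ quotient-coefficient k (suc n) ⟩
      F 1 (k ℕ.+ suc n)
        ≡⟨ ≡.cong (F 1) (ℕₚ.+-suc k n) ⟩
      F 1 (suc k ℕ.+ n) ∎
      where open SetoidReasoning setoid

  denominator-constantTerm : denominator 0 0 ≈ 1#
  denominator-constantTerm = fromOdd-constantTerm (suc r)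
    {λ k → (-ₛ t) *ₛ odds 0 k} {λ k → (-ₛ t) *ₛ evens 0 k}
    (λ k → *ₛ-constantTerm-zero { -ₛ t} -0#≈0# (odds 0 k))
    (λ k → *ₛ-constantTerm-zero { -ₛ t} -0#≈0# (evens 0 k))
    where open RingProperties ring using (-0#≈0#)

  generatingFunction : ∀ (y : ℕ → Carrier) →
    (∀ k → y (suc (double k)) ≈ y-odd 0 k) → (∀ k → y (suc (suc (double k))) ≈ y-even 0 k) →
    ∀ (w : Vector Series (suc (2 ℕ.* r))) → (∀ i → w i ≈ₛ -ₛ (t *ₛ const (y (suc (toℕ i))))) →
    F 1 ≈ₛ const (F 1 0) *ₛ (Z (0ₛ ∷ tail w) /ₛ Z w)
  generatingFunction y y≈odd y≈even w w≈ n = begin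
    F 1 n
      ≡⟨ ≡.cong (F 1) (ℕₚ.+-identityʳ n) ⟨
    F 1 (n ℕ.+ 0)
      ≈⟨ quotient-coefficient (Z w ⁻¹ₛ) (S.trans (S.*-congʳ {Z w ⁻¹ₛ} (S.sym Z≈)) (⁻¹ₛ-inverse (Z w) Z₀≉0)) n 0 ⟨
    (const (F 1 0) *ₛ (numerator 0 *ₛ Z w ⁻¹ₛ)) n
      ≈⟨ S.*-congˡ {const (F 1 0)} (S.*-congʳ {Z w ⁻¹ₛ} Z₀≈) n ⟨
    (const (F 1 0) *ₛ (Z (0ₛ ∷ tail w) *ₛ Z w ⁻¹ₛ)) n ∎
    where
    open SetoidReasoning setoid

    z : ℕ → Series
    z i = (-ₛ t) *ₛ const (y (suc i))

    w≈z : ∀ i → w i ≈ₛ z (toℕ i)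
    w≈z i = S.trans (w≈ i) (-‿distribˡ-* t (const (y (suc (toℕ i)))))

    interleaves : Interleaves z (λ k → (-ₛ t) *ₛ odds 0 k) (λ k → (-ₛ t) *ₛ evens 0 k)
    interleaves k = S.*-congˡ { -ₛ t} (const-cong (y≈odd k)) , S.*-congˡ { -ₛ t} (const-cong (y≈even k))

    Z≈ : Z w ≈ₛ denominator 0
    Z≈ = S.trans (Z≈transfer r w z w≈z) (transfer-odd r z interleaves)

    Z₀≈ : Z (0ₛ ∷ tail w) ≈ₛ numerator 0
    Z₀≈ = S.trans (Z-vacant₁≈transfer r w z (λ i → w≈z (suc i))) (transfer-even r z interleaves)

    Z₀≉0 : ¬ (Z w 0 ≈ 0#)
    -- The constant term is 1, which makes `Z w ⁻¹ₛ` a genuine inverse.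
    Z₀≉0 eq = 1≉0 (trans (sym (trans (Z≈ 0) denominator-constantTerm)) eq)

-- Weights by parity of the label, and restriction to nonnegative times

⌊double/2⌋ : ∀ k → ⌊ double k /2⌋ ≡ k
⌊double/2⌋ zero    = ≡.refl
⌊double/2⌋ (suc k) = ≡.cong suc (⌊double/2⌋ k)

*2≡double : ∀ k → k ℕ.* 2 ≡ double k
*2≡double k = ≡.trans (ℕₚ.*-comm k 2) (2*≡double k)

2∣double : ∀ k → 2 ∣ double k
2∣double k = divides k (≡.sym (*2≡double k))

1+double≢double : ∀ k q → suc (double k) ≢ double q
1+double≢double (suc k) (suc q) eq = 1+double≢double k q (ℕₚ.suc-injective (ℕₚ.suc-injective eq))

2∤1+double : ∀ k → ¬ (2 ∣ suc (double k))
2∤1+double k (divides q eq) = 1+double≢double k q (≡.trans eq (*2≡double q))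

module _ (r : ℕ) (R : ℕ → ℤ → DecField.Carrier (QSystem.K r)) where
  open QSystem r
  open DecField K using (_≈_; _*_; _+_)
  open Weights R

  y-odd-label : ∀ k → y (suc (double k)) ≡ y-odd (suc k)
  y-odd-label k
    rewrite dec-false (2 ∣? suc (double k)) (2∤1+double k) | ⌊double/2⌋ k = ≡.refl

  y-even-label : ∀ k → y (suc (suc (double k))) ≡ y-even (suc k)
  y-even-label k
    rewrite dec-true (2 ∣? suc (suc (double k))) (2∣double (suc k)) | ⌊double/2⌋ k = ≡.refl

  isQSystemℕ : IsQSystem R → IsQSystemℕ K r (λ α n → R α (+ n))
  isQSystemℕ isQ = record
    { nonzero    = λ α n → nonzero α (+ n)
    ; boundary₀  = λ n → boundary₀ (+ n)
    ; boundary₁  = λ n → boundary₁ (+ n)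
    ; recurrence = λ α n α<r →
        -- The lowered indices reduce by computation; the raised ones end in `+ 1` and have to be
        -- commuted.
        ≡.subst₂ (λ m β → R (suc α) (+ m) * R (suc α) (+ n)
              ≈ R (suc α) (+ suc n) * R (suc α) (+ suc n) + R β (+ suc n) * R α (+ suc n))
          (ℕₚ.+-comm (suc n) 1) (ℕₚ.+-comm (suc α) 1)
          (recurrence (suc α) (+ suc n) (s≤s z≤n) α<r)
    }
    where open IsQSystem isQ

mainTheorem8 : ∀ (r : ℕ) → 1 ≤ r → (R : ℕ → ℤ → DecField.Carrier (QSystem.K r)) → QSystem.IsQSystem r R →
    let open GeneratingFunction r R in
    ∑R₁ₙtⁿ ≈ₛ const (R 1 (+ 0)) *ₛ (Z (0ₛ ∷ tail -ty) /ₛ Z -ty)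
mainTheorem8 r _ R isQ =
  QSystemSeries.generatingFunction (QSystem.K r) r (λ α n → R α (+ n)) (isQSystemℕ r R isQ) y
    (λ k → reflexive (y-odd-label r R k))
    (λ k → reflexive (≡.trans (y-even-label r R k) (y-even-+1 k)))
    -ty (λ i n → refl)
  where
  open GeneratingFunction r R
  open DecField (QSystem.K r) using (reflexive; refl; _*_; _/_)

  y-even-+1 : ∀ k → y-even (suc k)
    ≡ (R k (+ 0) * R (suc (suc k)) (+ 1)) / (R (suc k) (+ 0) * R (suc k) (+ 1))
  y-even-+1 k = ≡.cong (λ α → (R k (+ 0) * R (suc α) (+ 1)) / (R (suc k) (+ 0) * R (suc k) (+ 1)))
    (ℕₚ.+-comm k 1)
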